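{- A first-order theory $T$ has NIP if and only if the following holds: for every model $M$ of $T$, every linearly ordered graph $I$ (symmetric, with no loops) that is a quantifier-free weakly-saturated model of $T_g$, and every $I$-indexed ordered graph-indiscernible $(a_i : i \in I)$ in $M$, the sequence $(a_i : i \in I)$ is an indiscernible sequence with respect to the linear order $<$ of $I$.
   Context: $L_g=\{<,R\}$ is the language with two binary relation symbols (an order and an edge relation), and $T_g$ is the $L_g$-theory of linearly ordered symmetric graphs with no loops: $<$ is a linear order, and $R$ is symmetric and irreflexive. A model $I$ of a theory $T'$ is a quantifier-free weakly-saturated model of $T'$ if it realizes all complete quantifier-free types (in finitely many variables, in the language of $T'$) consistent with $T'$; for $T_g$ this is equivalent to saying that every finite model of $T_g$ embeds in $I$ as a substructure. Let $I$ be an $L_g$-structure, $M$ an $L$-structure, and $(a_i : i\in I)$ a family of elements of $M^k$ for some fixed finite $k\ge 1$ (each $a_i$ may thus be a finite tuple, treated notationally as a single element). The family is an ordered graph-indiscernible in $M$ (i.e. $L_g$-generalized indiscernible) if for all finite $n$ and all $i_1,\dots,i_n,j_1,\dots,j_n$ in $I$, $$\mathrm{qftp}^{L_g}(i_1,\dots,i_n;I)=\mathrm{qftp}^{L_g}(j_1,\dots,j_n;I)\ \Rightarrow\ \mathrm{tp}^{L}(a_{i_1},\dots,a_{i_n};M)=\mathrm{tp}^{L}(a_{j_1},\dots,a_{j_n};M),$$ where $\mathrm{qftp}$ is the complete quantifier-free type and $\mathrm{tp}^L$ is the complete $L$-type over $\emptyset$. Generalized indiscernibles are always assumed nontrivial: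 $a_i\neq a_j$ whenever $i\ne j$. The family is an indiscernible sequence if $\mathrm{tp}^{L}(a_{i_1},\dots,a_{i_n};M)=\mathrm{tp}^{L}(a_{j_1},\dots,a_{j_n};M)$ for all $n$ and all $i_1<\dots<i_n$, $j_1<\dots<j_n$ in $I$. A theory $T$ has the independence property (IP) if there is a partitioned formula $\varphi(x;y)$ in the language of $T$ ($x,y$ finite tuples of variables) such that for every $n$ there are parameters $a_1,\dots,a_n,b_1,\dots,b_{2^n}$ in some model of $T$ such that, where $\{w_t:1\le t\le 2^n\}$ enumerates the subsets of $\{1,\dots,n\}$, $\varphi(b_t;a_i)$ holds if and only if $i\in w_t$. $T$ has NIP if it does not have IP. -}

module Defs where

open import Level using (Level; _⊔_; 0ℓ) renaming (suc to lsuc)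
open import Data.Nat.Base using (ℕ; suc; _+_; _*_)
open import Data.Fin.Base using (Fin; zero; suc)
open import Data.Fin.Subset using (Subset) renaming (_∈_ to _∈ₛ_)
open import Data.Vec.Base using (Vec; []; _∷_; lookup; map; concat; _++_)
open import Data.Vec.Relation.Unary.Linked using (Linked)
open import Data.Product.Base using (_×_; Σ-syntax)
open import Data.Sum.Base using (_⊎_)
open import Data.Empty.Polymorphic using (⊥)
open import Function.Bundles using (_⇔_)
open import Relation.Nullary using (¬_)
open import Relation.Unary using (Pred; _∈_; _⊆_; _≐_)
open import Relation.Binary.PropositionalEquality.Core using (_≡_; _≢_)

private
  variable
    l m : Level

record Language (l : Level) : Set (lsuc l) where
  field
    Func : ℕ → Set l
    Rel  : ℕ → Set l

open Language public

data Term (L : Language l) (n : ℕ) : Set l where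
  var : Fin n → Term L n
  fn  : ∀ {k} → Func L k → Vec (Term L n) k → Term L n

infix  8 _==_
infixr 6 _∨ᶠ_
infixr 5 _⇒ᶠ_

-- Formulas whose free variables are among n many.  Variables are de Bruijn
-- indices: the variable bound by allᶠ is `zero` in its body.  The metatheory is
-- classical, so ⊥, ⇒ and ∀ form a complete set of connectives.
data Formula (L : Language l) (n : ℕ) : Set l where
  ⊥ᶠ   : Formula L n
  _==_ : Term L n → Term L n → Formula L n
  rel  : ∀ {k} → Rel L k → Vec (Term L n) k → Formula L n
  _⇒ᶠ_ : Formula L n → Formula L n → Formula L n
  allᶠ : Formula L (suc n) → Formula L n

¬ᶠ_ : {L : Language l} {n : ℕ} → Formula L n → Formula L n
¬ᶠ φ = φ ⇒ᶠ ⊥ᶠ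

_∨ᶠ_ : {L : Language l} {n : ℕ} → Formula L n → Formula L n → Formula L n
φ ∨ᶠ ψ = (¬ᶠ φ) ⇒ᶠ ψ

infix 7 ¬ᶠ_

data QuantifierFree {L : Language l} {n : ℕ} : Pred (Formula L n) l where
  ⊥ᶠ   : QuantifierFree ⊥ᶠ
  _==_ : ∀ s t → QuantifierFree (s == t)
  rel  : ∀ {k} (r : Rel L k) ts → QuantifierFree (rel r ts)
  _⇒ᶠ_ : ∀ {φ ψ} → QuantifierFree φ → QuantifierFree ψ → QuantifierFree (φ ⇒ᶠ ψ)

Sentence : Language l → Set l
Sentence L = Formula L 0

Theory : Language l → Set (lsuc l)
Theory {l} L = Pred (Sentence L) l

-- As usual in first-order logic, structures are nonempty; `point` records this
-- and plays no other role.
record Structure (L : Language l) (m : Level) : Set (l ⊔ lsuc m) where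
  field
    Carrier : Set m
    point   : Carrier
    funcᴵ   : ∀ {k} → Func L k → Vec Carrier k → Carrier
    relᴵ    : ∀ {k} → Rel L k → Vec Carrier k → Set m

open Structure public

module _ {L : Language l} (M : Structure L m) {n : ℕ} (v : Vec (Carrier M) n) where

  mutual
    eval : Term L n → Carrier M
    eval (var i)   = lookup v i
    eval (fn f ts) = funcᴵ M f (evals ts)

    evals : ∀ {k} → Vec (Term L n) k → Vec (Carrier M) k
    evals []       = []
    evals (t ∷ ts) = eval t ∷ evals ts

infix 4 _⊨_[_] _⊨ᵀ_

_⊨_[_] : {L : Language l} (M : Structure L m) {n : ℕ} →
         Formula L n → Vec (Carrier M) n → Set m
M ⊨ ⊥ᶠ       [ v ] = ⊥
M ⊨ s == t   [ v ] = eval M v s ≡ eval M v t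
M ⊨ rel r ts [ v ] = relᴵ M r (evals M v ts)
M ⊨ φ ⇒ᶠ ψ   [ v ] = M ⊨ φ [ v ] → M ⊨ ψ [ v ]
M ⊨ allᶠ φ   [ v ] = (x : Carrier M) → M ⊨ φ [ x ∷ v ]

_⊨ᵀ_ : {L : Language l} → Structure L m → Theory L → Set (l ⊔ m)
M ⊨ᵀ T = ∀ σ → σ ∈ T → M ⊨ σ [ [] ]

-- Types are sets of formulas, compared with _≐_ (mutual inclusion).
tp : {L : Language l} (M : Structure L m) {n : ℕ} →
     Vec (Carrier M) n → Pred (Formula L n) m
tp M v φ = M ⊨ φ [ v ]

qftp : {L : Language l} (M : Structure L m) {n : ℕ} →
       Vec (Carrier M) n → Pred (Formula L n) (l ⊔ m)
qftp M v φ = QuantifierFree φ × M ⊨ φ [ v ]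

module _ {L : Language l} {n : ℕ} where

  IsCompleteQFType : Pred (Formula L n) m → Set (l ⊔ m)
  IsCompleteQFType p =
    (p ⊆ QuantifierFree) × (∀ φ → QuantifierFree φ → φ ∈ p ⊎ (¬ᶠ φ) ∈ p)

  Realizes : (M : Structure L m) → Vec (Carrier M) n → Pred (Formula L n) m → Set (l ⊔ m)
  Realizes M v p = ∀ φ → φ ∈ p → M ⊨ φ [ v ]

  -- p is consistent with T when T ∪ p(x₁,…,xₙ) is satisfiable.
  ConsistentWith : Theory L → Pred (Formula L n) m → Set (l ⊔ lsuc m)
  ConsistentWith {m} T p =
    Σ[ N ∈ Structure L m ] N ⊨ᵀ T × Σ[ c ∈ Vec (Carrier N) n ] Realizes N c p

IsQFWeaklySaturatedModel : {L : Language l} → Theory L → Structure L m → Set (l ⊔ lsuc m)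
IsQFWeaklySaturatedModel {m = m} {L = L} T I =
  I ⊨ᵀ T ×
  (∀ n (p : Pred (Formula L n) m) → IsCompleteQFType p → ConsistentWith T p →
     Σ[ i ∈ Vec (Carrier I) n ] Realizes I i p)

data GraphRel : ℕ → Set where
  lt edge : GraphRel 2

data NoSymbol : ℕ → Set where

Lg : Language 0ℓ
Lg = record { Func = NoSymbol ; Rel = GraphRel }

infix 8 _<ᶠ_ _Rᶠ_

_<ᶠ_ _Rᶠ_ : ∀ {n} → Fin n → Fin n → Formula Lg n
i <ᶠ j = rel lt   (var i ∷ var j ∷ [])
i Rᶠ j = rel edge (var i ∷ var j ∷ [])

pattern x₀ = zero
pattern x₁ = suc zero
pattern x₂ = suc (suc zero)

data Tg : Theory Lg where
  <-irreflexive : Tg (allᶠ (¬ᶠ (x₀ <ᶠ x₀)))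
  <-transitive  : Tg (allᶠ (allᶠ (allᶠ (x₀ <ᶠ x₁ ⇒ᶠ x₁ <ᶠ x₂ ⇒ᶠ x₀ <ᶠ x₂))))
  <-total       : Tg (allᶠ (allᶠ (x₀ <ᶠ x₁ ∨ᶠ var x₀ == var x₁ ∨ᶠ x₁ <ᶠ x₀)))
  R-symmetric   : Tg (allᶠ (allᶠ (x₀ Rᶠ x₁ ⇒ᶠ x₁ Rᶠ x₀)))
  R-irreflexive : Tg (allᶠ (¬ᶠ (x₀ Rᶠ x₀)))

module _ {l l′ m m′ : Level} {L′ : Language l′} {L : Language l}
         (I : Structure L′ m′) (M : Structure L m)
         {k : ℕ} (a : Carrier I → Vec (Carrier M) k) where

  tuple : ∀ {n} → Vec (Carrier I) n → Vec (Carrier M) (n * k)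
  tuple i = concat (map a i)

  -- Nontriviality is part of the notion.
  IsGeneralizedIndiscernible : Set (l ⊔ l′ ⊔ m ⊔ m′)
  IsGeneralizedIndiscernible =
    (∀ i j → i ≢ j → a i ≢ a j) ×
    (∀ n (i j : Vec (Carrier I) n) →
       qftp I i ≐ qftp I j → tp M (tuple i) ≐ tp M (tuple j))

Increasing : (I : Structure Lg m) {n : ℕ} → Vec (Carrier I) n → Set m
Increasing I = Linked (λ x y → relᴵ I lt (x ∷ y ∷ []))

IsIndiscernibleSequence : {l m m′ : Level} {L : Language l}
  (I : Structure Lg m′) (M : Structure L m) {k : ℕ}
  (a : Carrier I → Vec (Carrier M) k) → Set (l ⊔ m ⊔ m′)
IsIndiscernibleSequence I M a =
  ∀ n (i j : Vec (Carrier I) n) → Increasing I i → Increasing I j →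
    tp M (tuple I M a i) ≐ tp M (tuple I M a j)

-- φ(x;y) with |x| = p and |y| = q is a formula in p + q variables, x first.  The
-- parameters b are indexed by the subsets of Fin n themselves rather than by an
-- enumeration of them.
HasIP : {L : Language l} → Theory L → Set (lsuc l)
HasIP {l} {L} T =
  Σ[ p ∈ ℕ ] Σ[ q ∈ ℕ ] Σ[ φ ∈ Formula L (p + q) ] (∀ n →
    Σ[ M ∈ Structure L l ] M ⊨ᵀ T ×
    Σ[ a ∈ (Fin n → Vec (Carrier M) q) ]
    Σ[ b ∈ (Subset n → Vec (Carrier M) p) ]
      (∀ w i → (M ⊨ φ [ b w ++ a i ]) ⇔ (i ∈ₛ w)))

HasNIP : {L : Language l} → Theory L → Set (lsuc l)
HasNIP T = ¬ HasIP T

{-# OPTIONS --safe #-}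
module Submission where

-- If a formula on increasing tuples depends on the graph and not only on the order, then
-- changing one edge at a time there is a single edge (s , t) on which its truth depends.
-- Replacing s and t by many copies joined by an arbitrary bipartite graph, the formula
-- codes arbitrary subsets, which is IP.
--
-- Conversely, given an IP formula φ(x;y), code the vertices of a finite ordered graph by
-- tuples b ++ a such that φ links adjacent vertices.  The Graham–Rothschild theorem gives
-- codings for which finitely many formulas depend only on the ordered graph, and an
-- ultraproduct of these codings is an ordered graph-indiscernible, indexed by the Rado
-- graph, which is not an indiscernible sequence since φ sees the edges.

-- Why parameter words: IP offers, for every `N′`, a tuple for each subset of an `N′`-element set
-- and one for each element. A parameter word of length `N′` turns values of its parameters into a
-- subset, and the first occurrence of a parameter is an element at which its value can be read.
-- Substitution of words moves sets and elements together and preserves membership, so homogeneity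
-- for words becomes homogeneity for coded graphs. A vertex carries both a set and an element
-- because φ relates two kinds of tuples, while any vertex can be at either end of an edge. One
-- Ramsey coding serves finitely many formulas below a bound, in a model that varies with `N′`; the
-- ultraproduct is therefore indexed by the finite lists of requirements, and it stays at the
-- universe level of the language. In the other direction the edge (s , t) decides the formula only
-- up to negation. The negation is absorbed in the choice of the bipartite graph, so the same
-- formula witnesses IP in both cases.

open import Defs
open import Level using (Level; Lift; lift; lower; 0ℓ) renaming (suc to lsuc)
open import Axiom.ExcludedMiddle using (ExcludedMiddle)
open import Axiom.Extensionality.Propositional using (Extensionality)
open import Axiom.UniquenessOfIdentityProofs.WithK using (uip)
open import Data.Bool.Base using (Bool; true; false; _∧_; _∨_; if_then_else_; not)
import Data.Bool.Properties as Boolₚ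
open import Data.Empty using (⊥; ⊥-elim)
import Data.Empty.Polymorphic as Polymorphic
open import Data.Fin.Base as Fin
  using (Fin; zero; suc; toℕ; fromℕ<; combine; remQuot; splitAt; funToFin; finToFun; _↑ˡ_; _↑ʳ_)
import Data.Fin.Properties as Finₚ
open import Data.Fin.Subset using (Subset) renaming (_∈_ to _∈ₛ_)
open import Data.List.Base as List using (List; []; _∷_; length)
open import Data.List.Membership.Propositional using () renaming (_∈_ to _∈ᴸ_)
open import Data.List.Membership.Propositional.Properties using (∈-allFin; ∈-lookup)
open import Data.List.Relation.Unary.All as All using (All; []; _∷_)
import Data.List.Relation.Unary.All.Properties as Allₚ
open import Data.List.Relation.Unary.AllPairs using (AllPairs; []; _∷_)
open import Data.List.Relation.Unary.Any as Any using () renaming (here to hereᴸ; there to thereᴸ)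
open import Data.List.Relation.Unary.Any.Properties using (lookup-index)
open import Data.Maybe.Base as Maybe using (Maybe; just; nothing; fromMaybe; maybe′)
open import Data.Nat.Base as ℕ
  using (ℕ; zero; suc; _+_; _*_; _^_; _≤_; _<ᵇ_; z≤n; s≤s; ⌊_/2⌋)
import Data.Nat.Properties as ℕₚ
open import Data.Product.Base using (Σ; Σ-syntax; ∃; ∃-syntax; _×_; _,_; proj₁; proj₂)
open import Data.Sum.Base using (_⊎_; inj₁; inj₂; [_,_]′)
open import Data.Vec.Base using (Vec; []; _∷_; lookup; map; _++_; concat; tabulate; allFin;
  toList; replicate; _[_]≔_)
import Data.Vec.Properties as Vecₚ
open import Data.Vec.Membership.Propositional using () renaming (_∈_ to _∈ᵛ_)
open import Data.Vec.Membership.Propositional.Properties using (∈-map⁺; ∈-++⁺ˡ; ∈-++⁺ʳ)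
open import Data.Vec.Relation.Unary.Any using (here; there)
open import Data.Vec.Relation.Unary.Linked using ([-]; _∷_)
open import Data.Vec.Relation.Unary.Linked.Properties using (lookup⁺)
open import Function.Base using (_∘_; id; case_of_)
open import Function.Bundles using (_⇔_; mk⇔; Equivalence)
open import Relation.Binary.Definitions using (tri<; tri≈; tri>)
open import Relation.Binary.PropositionalEquality
  using (_≡_; _≢_; refl; sym; trans; cong; cong₂; subst; subst₂; module ≡-Reasoning)
open import Relation.Nullary using (¬_; Dec; yes; no; does; contradiction)
open import Relation.Nullary.Decidable using (isYes; decidable-stable; dec-true; dec-false)
open import Relation.Unary using (_∈_; _≐_)

open Equivalence using (to; from)

-- The Hales–Jewett theorem

Line : ℕ → ℕ → Set
Line a n = Vec (Maybe (Fin a)) n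

fill : ∀ {a n} → Line a n → Fin a → Vec (Fin a) n
fill L x = map (fromMaybe x) L

Monochromatic : ∀ {a n} {C : Set} → (Vec (Fin a) n → C) → Set
Monochromatic {a} {n} χ =
  Σ[ L ∈ Line a n ] nothing ∈ᵛ L × (∀ x y → χ (fill L x) ≡ χ (fill L y))

HJ : ℕ → ℕ → ℕ → Set
HJ a r n = (χ : Vec (Fin a) n → Fin r) → Monochromatic χ

decode : ∀ {a n} → Fin (a ^ n) → Vec (Fin a) n
decode {a} {n} i = tabulate (finToFun {a} {n} i)

encode : ∀ {a n} → Vec (Fin a) n → Fin (a ^ n)
encode w = funToFin (lookup w)

decode-encode : ∀ {a n} (w : Vec (Fin a) n) → decode (encode w) ≡ w
decode-encode w =
  trans (Vecₚ.tabulate-cong (Finₚ.finToFun-funToFin (lookup w))) (Vecₚ.tabulate∘lookup w)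

-- A function into `Fin r` on `Fin s` is one of `r ^ s` colours. With `s` the number of tails, this
-- colours a head by its effect on every tail.
HJ-function-colours : ∀ {a r n s} → HJ a (r ^ s) n →
  (χ : Vec (Fin a) n → Fin s → Fin r) →
  Σ[ L ∈ Line a n ] nothing ∈ᵛ L × (∀ x y i → χ (fill L x) i ≡ χ (fill L y) i)
HJ-function-colours {r = r} {s = s} hj χ with hj (λ w → funToFin (χ w))
... | L , L-active , mono = L , L-active , λ x y i →
  trans (sym (Finₚ.finToFun-funToFin (χ (fill L x)) i))
 (trans (cong (λ c → finToFun {r} {s} c i) (mono x y))
        (Finₚ.finToFun-funToFin (χ (fill L y)) i))

fill-++ : ∀ {a m n} (L : Line a m) (L′ : Line a n) x →
           fill (L ++ L′) x ≡ fill L x ++ fill L′ x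
fill-++ L L′ x = Vecₚ.map-++ (fromMaybe x) L L′

fill-constant : ∀ {a n} (w : Vec (Fin a) n) x → fill (map just w) x ≡ w
fill-constant w x = trans (sym (Vecₚ.map-∘ _ _ w)) (Vecₚ.map-id w)

shift : ∀ {a n} → Line a n → Line (suc a) n
shift = map (Maybe.map suc)

fill-shift : ∀ {a n} (L : Line a n) x → fill (shift L) (suc x) ≡ map suc (fill L x)
fill-shift []            x = refl
fill-shift (just c ∷ L)  x = cong (suc c ∷_) (fill-shift L x)
fill-shift (nothing ∷ L) x = cong (suc x ∷_) (fill-shift L x)

-- Colour focusing: j active lines whose points at letter 0 all coincide, each of them
-- monochromatic on the letters 1, …, a + 1, with distinct colours that also differ from
-- the colour of the focus.
record Focused {a r n : ℕ} (χ : Vec (Fin (suc (suc a))) n → Fin r) (j : ℕ) : Set where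
  field
    lines       : Fin j → Line (suc (suc a)) n
    focus       : Vec (Fin (suc (suc a))) n
    colour      : Fin (suc j) → Fin r
    active      : ∀ i → nothing ∈ᵛ lines i
    focussing   : ∀ i → fill (lines i) zero ≡ focus
    coloured    : ∀ i x → χ (fill (lines i) (suc x)) ≡ colour (suc i)
    colourFocus : χ focus ≡ colour zero
    distinct    : ∀ i i′ → colour i ≡ colour i′ → i ≡ i′

-- Heads over the nonzero letters are coloured by their effect on all tails; along the line found,
-- tails cannot tell the nonzero letters apart. Focused lines of tails are prolonged by it. The
-- colour of the new focus either repeats, which completes a monochromatic line, or is one more
-- colour.
focusing : ∀ a r → (∀ r′ → ∃ (HJ (suc a) r′)) → ∀ j →
           ∃[ n ] ((χ : Vec (Fin (suc (suc a))) n → Fin r) → Monochromatic χ ⊎ Focused χ j)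
focusing a r hj zero = 0 , λ χ → inj₂ record
  { lines = λ () ; focus = [] ; colour = λ _ → χ [] ; active = λ ()
  ; focussing = λ () ; coloured = λ () ; colourFocus = refl
  ; distinct = λ { zero zero _ → refl } }
focusing a r hj (suc j) with focusing a r hj j
... | n₂ , ih with hj (r ^ (suc (suc a) ^ n₂))
... | n₁ , hj₁ = n₁ + n₂ , step
  where
  step : (χ : Vec (Fin (suc (suc a))) (n₁ + n₂) → Fin r) → Monochromatic χ ⊎ Focused χ (suc j)
  step χ with HJ-function-colours hj₁ (λ u i → χ (map suc u ++ decode i))
  ... | L , L-active , indep = result (ih f)
    where
    f : Vec (Fin (suc (suc a))) n₂ → Fin r
    -- This `zero` is in the smaller alphabet, so the head is filled with letter 1; by `f-indep` the
    -- other nonzero letters give the same `f`.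
    f z = χ (map suc (fill L zero) ++ z)

    L↑ = shift L

    f-indep : ∀ x z → χ (fill L↑ (suc x) ++ z) ≡ f z
    f-indep x z = subst
      (λ z → χ (fill L↑ (suc x) ++ z) ≡ χ (map suc (fill L zero) ++ z))
      (decode-encode z)
      (trans (cong (λ u → χ (u ++ decode (encode z))) (fill-shift L x))
             (indep x zero (encode z)))

    L↑-active : nothing ∈ᵛ L↑
    L↑-active = ∈-map⁺ (Maybe.map suc) L-active

    result : Monochromatic f ⊎ Focused f j → Monochromatic χ ⊎ Focused χ (suc j)
    result (inj₁ (L₂ , L₂-active , mono)) = inj₁
      ( map just w₁ ++ L₂ , ∈-++⁺ʳ (map just w₁) L₂-active
      , λ x y → trans (eq x) (trans (mono x y) (sym (eq y))))
      where
      w₁ = map suc (fill L zero)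
      eq : ∀ x → χ (fill (map just w₁ ++ L₂) x) ≡ f (fill L₂ x)
      eq x = cong χ (trans (fill-++ (map just w₁) L₂ x)
                           (cong (_++ fill L₂ x) (fill-constant w₁ x)))
    result (inj₂ F) = decide (Finₚ.any? (λ i → χ focus′ Finₚ.≟ colour i))
      where
      open Focused F
      focus′ = fill L↑ zero ++ focus

      lines′ : Fin (suc j) → Line (suc (suc a)) (n₁ + n₂)
      -- The extra line moves only in the head and keeps the old focus as its tail, so on nonzero
      -- letters it has the colour of the old focus.
      lines′ zero    = L↑ ++ map just focus
      lines′ (suc i) = L↑ ++ lines i

      active′ : ∀ i → nothing ∈ᵛ lines′ i
      active′ zero    = ∈-++⁺ˡ L↑-active
      active′ (suc i) = ∈-++⁺ˡ L↑-active

      focussing′ : ∀ i → fill (lines′ i) zero ≡ focus′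
      focussing′ zero    = trans (fill-++ L↑ _ zero) (cong (fill L↑ zero ++_) (fill-constant focus zero))
      focussing′ (suc i) = trans (fill-++ L↑ _ zero) (cong (fill L↑ zero ++_) (focussing i))

      coloured′ : ∀ i x → χ (fill (lines′ i) (suc x)) ≡ colour i
      coloured′ zero x = begin
        χ (fill (L↑ ++ map just focus) (suc x))
          ≡⟨ cong χ (fill-++ L↑ _ (suc x)) ⟩
        χ (fill L↑ (suc x) ++ fill (map just focus) (suc x))
          ≡⟨ f-indep x _ ⟩
        f (fill (map just focus) (suc x))
          ≡⟨ cong f (fill-constant focus (suc x)) ⟩
        f focus
          ≡⟨ colourFocus ⟩
        colour zero ∎
        where open ≡-Reasoning
      coloured′ (suc i) x =
        trans (cong χ (fill-++ L↑ _ (suc x))) (trans (f-indep x _) (coloured i x))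

      decide : Dec (∃ λ i → χ focus′ ≡ colour i) → Monochromatic χ ⊎ Focused χ (suc j)
      decide (yes (i , eq)) = inj₁ (lines′ i , active′ i , λ x y → trans (all x) (sym (all y)))
        where
        all : ∀ x → χ (fill (lines′ i) x) ≡ colour i
        all zero    = trans (cong χ (focussing′ i)) eq
        all (suc x) = coloured′ i x
      decide (no new) = inj₂ record
        { lines = lines′ ; focus = focus′ ; colour = colour′ ; active = active′
        ; focussing = focussing′ ; coloured = coloured′ ; colourFocus = refl
        ; distinct = distinct′ }
        where
        colour′ : Fin (suc (suc j)) → Fin r
        colour′ zero    = χ focus′
        colour′ (suc i) = colour i

        distinct′ : ∀ i i′ → colour′ i ≡ colour′ i′ → i ≡ i′
        distinct′ zero    zero     eq = refl
        distinct′ zero    (suc i′) eq = contradiction (i′ , eq) new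
        distinct′ (suc i) zero     eq = contradiction (i , sym eq) new
        distinct′ (suc i) (suc i′) eq = cong suc (distinct i i′ eq)

-- After `r` rounds, focused lines and focus would show `r + 1` distinct colours out of `r`.
halesJewett : ∀ a r → ∃ (HJ a r)
halesJewett zero          r = 1 , λ χ → nothing ∷ [] , here refl , λ ()
halesJewett (suc zero)    r = 1 , λ χ → nothing ∷ [] , here refl , λ { zero zero → refl }
halesJewett (suc (suc a)) r with focusing a r (halesJewett (suc a)) r
... | n , mono-or-focused = n , λ χ → conclude (mono-or-focused χ)
  where
  conclude : {χ : Vec (Fin (suc (suc a))) n → Fin r} → Monochromatic χ ⊎ Focused χ r → Monochromatic χ
  conclude (inj₁ mono) = mono
  conclude (inj₂ F)    = contradiction (Finₚ.injective⇒≤ (λ {i} {j} → Focused.distinct F i j)) ℕₚ.1+n≰n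

-- Parameter words and the Graham–Rothschild theorem

-- Graham–Rothschild parameter words of length n over a letters, with k parameters.  Once
-- introduced, a parameter is a letter of the rest of the word: it becomes letter zero
-- there and the earlier letters are shifted.
data Word (a : ℕ) : ℕ → ℕ → Set where
  []  : Word a 0 0
  con : ∀ {k n} → Fin a → Word a k n → Word a k (suc n)
  new : ∀ {k n} → Word (suc a) k n → Word a (suc k) (suc n)

expand : ∀ {a k n} {B : Set} → Word a k n → Vec B a → Vec B k → Vec B n
expand []        ρ A       = []
expand (con c w) ρ A       = lookup ρ c ∷ expand w ρ A
expand (new w)   ρ (x ∷ A) = x ∷ expand w (x ∷ ρ) A

pos : ∀ {a k n} → Word a k n → Fin k → Fin n
pos (con c w) j       = suc (pos w j)
pos (new w)   zero    = zero
pos (new w)   (suc j) = suc (pos w j)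

-- Here positions become elements: whether `pos w j` lies in the set coded by the word is the value
-- of parameter `j`. Edges are read in this way.
lookup-expand-pos : ∀ {a k n} {B : Set} (w : Word a k n) (ρ : Vec B a) (A : Vec B k) j →
                    lookup (expand w ρ A) (pos w j) ≡ lookup A j
lookup-expand-pos (con c w) ρ A       j       = lookup-expand-pos w ρ A j
lookup-expand-pos (new w)   ρ (x ∷ A) zero    = refl
lookup-expand-pos (new w)   ρ (x ∷ A) (suc j) = lookup-expand-pos w (x ∷ ρ) A j

under : ∀ {a b} → Vec (Fin a) b → Vec (Fin (suc a)) (suc b)
under σ = zero ∷ map suc σ

-- Substitution of `g` for the parameters of `h`. The translation `σ` is needed because a parameter
-- that `g` replaces by a letter is still a further letter for the rest of `h`, but not for the rest
-- of `g`.
compose : ∀ {a b k m n} → Word b m n → Vec (Fin a) b → Word a k m → Word a k n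
compose []        σ []        = []
compose (con c h) σ g         = con (lookup σ c) (compose h σ g)
compose (new h)   σ (con y g) = con y (compose h (y ∷ σ) g)
compose (new h)   σ (new g)   = new (compose h (under σ) g)

infixr 9 _∙_
_∙_ : ∀ {a k m n} → Word a m n → Word a k m → Word a k n
h ∙ g = compose h (allFin _) g

map-lookup-under : ∀ {a b} {B : Set} (x : B) (ρ : Vec B a) (σ : Vec (Fin a) b) →
                   map (lookup (x ∷ ρ)) (under σ) ≡ x ∷ map (lookup ρ) σ
map-lookup-under x ρ σ = cong (x ∷_) (sym (Vecₚ.map-∘ (lookup (x ∷ ρ)) suc σ))

expand-compose : ∀ {a b k m n} {B : Set} (h : Word b m n) (σ : Vec (Fin a) b) (g : Word a k m)
                 (ρ : Vec B a) (A : Vec B k) →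
                 expand (compose h σ g) ρ A ≡ expand h (map (lookup ρ) σ) (expand g ρ A)
expand-compose []        σ []        ρ []      = refl
expand-compose (con c h) σ g         ρ A       =
  cong₂ _∷_ (sym (Vecₚ.lookup-map c (lookup ρ) σ)) (expand-compose h σ g ρ A)
expand-compose (new h)   σ (con y g) ρ A       = cong (lookup ρ y ∷_) (expand-compose h (y ∷ σ) g ρ A)
expand-compose (new h)   σ (new g)   ρ (x ∷ A) = cong (x ∷_)
  (trans (expand-compose h (under σ) g (x ∷ ρ) A)
         (cong (λ τ → expand h τ (expand g (x ∷ ρ) A)) (map-lookup-under x ρ σ)))

pos-compose : ∀ {a b k m n} (h : Word b m n) (σ : Vec (Fin a) b) (g : Word a k m) j →
              pos (compose h σ g) j ≡ pos h (pos g j)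
pos-compose []        σ []        ()
pos-compose (con c h) σ g         j       = cong suc (pos-compose h σ g j)
pos-compose (new h)   σ (con y g) j       = cong suc (pos-compose h (y ∷ σ) g j)
pos-compose (new h)   σ (new g)   zero    = refl
pos-compose (new h)   σ (new g)   (suc j) = cong suc (pos-compose h (under σ) g j)

under-under : ∀ {a b c} (τ : Vec (Fin a) b) (σ : Vec (Fin b) c) →
              map (lookup (under τ)) (under σ) ≡ under (map (lookup τ) σ)
under-under τ σ = trans (map-lookup-under zero (map suc τ) σ) (cong (zero ∷_) (trans
  (Vecₚ.map-cong (λ i → Vecₚ.lookup-map i suc τ) σ) (Vecₚ.map-∘ suc (lookup τ) σ)))

compose-assoc : ∀ {a b c k l m n} (h : Word c m n) (σ : Vec (Fin b) c) (g : Word b l m)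
                (τ : Vec (Fin a) b) (f : Word a k l) →
                compose (compose h σ g) τ f ≡ compose h (map (lookup τ) σ) (compose g τ f)
compose-assoc []        σ []        τ []        = refl
compose-assoc (con c h) σ g         τ f         =
  cong₂ con (sym (Vecₚ.lookup-map c (lookup τ) σ)) (compose-assoc h σ g τ f)
compose-assoc (new h)   σ (con y g) τ f         = cong (con _) (compose-assoc h (y ∷ σ) g τ f)
compose-assoc (new h)   σ (new g)   τ (con z f) = cong (con z)
  (trans (compose-assoc h (under σ) g (z ∷ τ) f)
         (cong (λ ρ → compose h ρ (compose g (z ∷ τ) f)) (map-lookup-under z τ σ)))
compose-assoc (new h)   σ (new g)   τ (new f)   = cong new
  (trans (compose-assoc h (under σ) g (under τ) f)
         (cong (λ ρ → compose h ρ (compose g (under τ) f)) (under-under τ σ)))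

map-lookup-allFin : ∀ {a} {B : Set} (ρ : Vec B a) → map (lookup ρ) (allFin a) ≡ ρ
map-lookup-allFin ρ = trans (sym (Vecₚ.tabulate-∘ (lookup ρ) id)) (Vecₚ.tabulate∘lookup ρ)

expand-∙ : ∀ {a k m n} {B : Set} (h : Word a m n) (g : Word a k m) (ρ : Vec B a) A →
           expand (h ∙ g) ρ A ≡ expand h ρ (expand g ρ A)
expand-∙ h g ρ A = trans (expand-compose h (allFin _) g ρ A)
  (cong (λ τ → expand h τ (expand g ρ A)) (map-lookup-allFin ρ))

∙-assoc : ∀ {a k l m n} (h : Word a m n) (g : Word a l m) (f : Word a k l) →
          (h ∙ g) ∙ f ≡ h ∙ (g ∙ f)
∙-assoc h g f = trans (compose-assoc h (allFin _) g (allFin _) f)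
  (cong (λ τ → compose h τ (g ∙ f)) (map-lookup-allFin (allFin _)))

under-allFin : ∀ a → under (allFin a) ≡ allFin (suc a)
under-allFin a = cong (zero ∷_) (sym (Vecₚ.tabulate-∘ suc id))

∙-new : ∀ {a k m n} (h : Word (suc a) m n) (g : Word (suc a) k m) →
        new h ∙ new g ≡ new (h ∙ g)
∙-new {a} h g = cong (λ τ → new (compose h τ g)) (under-allFin a)

identity : ∀ {a} k → Word a k k
identity zero    = []
identity (suc k) = new (identity k)

compose-identity : ∀ {a b k m} (τ : Vec (Fin a) b) (f : Word a k m) →
                   compose (identity m) τ f ≡ f
compose-identity τ []        = refl
compose-identity τ (con y f) = cong (con y) (compose-identity (y ∷ τ) f)
compose-identity τ (new f)   = cong new (compose-identity (under τ) f)

weaken : ∀ {a k n} → Word a k n → Word (suc a) k n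
weaken h = compose h (map suc (allFin _)) (identity _)

compose-weaken : ∀ {a b k m n} (h : Word b m n) x (σ : Vec (Fin a) b) (g : Word a k m) →
                 compose (weaken h) (x ∷ σ) g ≡ compose h σ g
compose-weaken h x σ g = trans (compose-assoc h _ (identity _) (x ∷ σ) g)
  (cong₂ (compose h)
    (trans (sym (Vecₚ.map-∘ (lookup (x ∷ σ)) suc (allFin _))) (map-lookup-allFin σ))
    (compose-identity (x ∷ σ) g))

prepend : ∀ {a k m n} → Vec (Fin a) m → Word a k n → Word a k (m + n)
prepend []      w = w
prepend (c ∷ u) w = con c (prepend u w)

compose-prepend : ∀ {a b k l m n} (u : Vec (Fin b) l) (h : Word b m n) (σ : Vec (Fin a) b)
                  (g : Word a k m) →
                  compose (prepend u h) σ g ≡ prepend (map (lookup σ) u) (compose h σ g)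
compose-prepend []      h σ g = refl
compose-prepend (c ∷ u) h σ g = cong (con (lookup σ c)) (compose-prepend u h σ g)

-- The line becomes the first parameter: it enters at the first active coordinate and recurs as
-- letter `zero` at the later ones. Weakening keeps it out of `h`, so filling it leaves `h`
-- untouched.
attach : ∀ {a k m n} (L : Line a m) → nothing ∈ᵛ L → Word a k n → Word a (suc k) (m + n)
attach (just c ∷ L)  (there p) h = con c (attach L p h)
attach (nothing ∷ L) p         h = new (prepend (map (maybe′ suc zero) L) (weaken h))

attach-con : ∀ {a b k l m n} (L : Line b l) p (h : Word b m n) (σ : Vec (Fin a) b) x
             (g : Word a k m) →
             compose (attach L p h) σ (con x g) ≡
             prepend (map (maybe′ (lookup σ) x) L) (compose h σ g)
attach-con (just c ∷ L)  (there p) h σ x g = cong (con (lookup σ c)) (attach-con L p h σ x g)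
attach-con (nothing ∷ L) p         h σ x g = cong (con x)
  (trans (compose-prepend _ (weaken h) (x ∷ σ) g)
  (cong₂ prepend
    (trans (sym (Vecₚ.map-∘ _ _ L)) (Vecₚ.map-cong (λ { (just c) → refl ; nothing → refl }) L))
    (compose-weaken h x σ g)))

attach-∙-con : ∀ {a k l m n} (L : Line a l) p (h : Word a m n) x (g : Word a k m) →
               attach L p h ∙ con x g ≡ prepend (fill L x) (h ∙ g)
attach-∙-con L p h x g = trans (attach-con L p h (allFin _) x g) (cong (λ u → prepend u (h ∙ g))
  (Vecₚ.map-cong (λ { (just c) → Vecₚ.lookup-allFin c ; nothing → refl }) L))

initial : ∀ {a k n} → Word a (suc k) n → List (Fin a)
initial (con c w) = c ∷ initial w
initial (new w)   = []

initial-prepend : ∀ {a k m n} (u : Vec (Fin a) m) (w : Word a (suc k) n) →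
                  initial (prepend u w) ≡ toList u List.++ initial w
initial-prepend []      w = refl
initial-prepend (c ∷ u) w = cong (c ∷_) (initial-prepend u w)

lead : ∀ {a n} → Line a n → List (Fin a)
lead []            = []
lead (just c ∷ L)  = c ∷ lead L
lead (nothing ∷ L) = []

initial-attach-new : ∀ {a b k l m n} (L : Line b l) p (h : Word b m n) (σ : Vec (Fin a) b)
                     (g : Word (suc a) k m) →
                     initial (compose (attach L p h) σ (new g)) ≡ List.map (lookup σ) (lead L)
initial-attach-new (just c ∷ L)  (there p) h σ g = cong (_ ∷_) (initial-attach-new L p h σ g)
initial-attach-new (nothing ∷ L) p         h σ g = refl

-- With `zero` as end marker, the possible initial segments are covered by the finitely many words
-- of length `n` over one more letter.
stop : ∀ {a n} → Vec (Fin (suc a)) n → List (Fin a)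
stop []          = []
stop (zero ∷ u)  = []
stop (suc c ∷ u) = c ∷ stop u

stop-surjective : ∀ {a k n} (w : Word a (suc k) n) → ∃ λ (u : Vec (Fin (suc a)) n) → stop u ≡ initial w
stop-surjective (con c w) with stop-surjective w
... | u , eq = suc c ∷ u , cong (c ∷_) eq
stop-surjective (new w) = replicate _ zero , refl

bit : Bool → Fin 2
bit false = zero
bit true  = suc zero

bit-injective : ∀ {x y} → bit x ≡ bit y → x ≡ y
bit-injective {false} {false} eq = refl
bit-injective {true}  {true}  eq = refl

halesJewett-Bool : ∀ a s → ∃[ n ] ((χ : Vec (Fin a) n → Fin s → Bool) →
  Σ[ L ∈ Line a n ] nothing ∈ᵛ L × (∀ x y i → χ (fill L x) i ≡ χ (fill L y) i))
halesJewett-Bool a s with halesJewett a (2 ^ s)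
... | n , hj = n , λ χ → reflect χ (HJ-function-colours hj (λ u i → bit (χ u i)))
  where
  reflect : (χ : Vec (Fin a) n → Fin s → Bool) → _ → _
  reflect χ (L , p , indep) = L , p , λ x y i → bit-injective (indep x y i)

-- Homogeneous subwords, by induction on the number of parameters

Homogeneous : ∀ {a k m n} → (Word a k n → Bool) → Word a m n → Set
Homogeneous χ h = ∃[ c ] (∀ g → χ (h ∙ g) ≡ c)

-- The alphabet is quantified inside because the step to `suc k` uses the case `k` over one more
-- letter: the first parameter is a letter of what follows it.
GrahamRothschild : ℕ → Set
GrahamRothschild k = ∀ a m → ∃[ n ] ((χ : Word a k n → Bool) →
  Σ[ h ∈ Word a m n ] Homogeneous χ h)

-- Finitely many colourings, which may even have different numbers of parameters.
simultaneous : ∀ {ℓ} {T : Set ℓ} (k : T → ℕ) → (∀ t → GrahamRothschild (k t)) → ∀ a m (ts : List T) →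
  ∃[ n ] ((χ : ∀ t → Word a (k t) n → Bool) →
    Σ[ h ∈ Word a m n ] (∀ {t} → t ∈ᴸ ts → Homogeneous (χ t) h))
simultaneous k gr a m []       = m , λ χ → identity m , λ ()
simultaneous k gr a m (t ∷ ts) with simultaneous k gr a m ts
... | n₀ , ih with gr t a n₀
... | n , gr₁ = n , λ χ → step χ (gr₁ (χ t))
  where
  step : ∀ χ → Σ[ h ∈ Word a n₀ n ] Homogeneous (χ t) h →
         Σ[ h ∈ Word a m n ] (∀ {t′} → t′ ∈ᴸ (t ∷ ts) → Homogeneous (χ t′) h)
  step χ (h₁ , c , hom₁) with ih (λ t′ g → χ t′ (h₁ ∙ g))
  ... | h₀ , hom = h₁ ∙ h₀ , λ
    { (hereᴸ refl) → c , λ g → trans (cong (χ t) (∙-assoc h₁ h₀ g)) (hom₁ (h₀ ∙ g))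
    ; (thereᴸ t∈) → proj₁ (hom t∈) , λ g →
        trans (cong (χ _) (∙-assoc h₁ h₀ g)) (proj₂ (hom t∈) g) }

simultaneous-Fin : ∀ {k} → GrahamRothschild k → ∀ s a m →
  ∃[ n ] ((χ : Fin s → Word a k n → Bool) → Σ[ h ∈ Word a m n ] (∀ i → Homogeneous (χ i) h))
simultaneous-Fin gr s a m with simultaneous (λ _ → _) (λ _ → gr) a m (List.allFin s)
... | n , sim = n , λ χ → let h , hom = sim χ in h , λ i → hom (∈-allFin i)

toWord : ∀ {a n} → Vec (Fin a) n → Word a 0 n
toWord []      = []
toWord (c ∷ u) = con c (toWord u)

toWord-surjective : ∀ {a n} (w : Word a 0 n) → ∃ λ u → toWord u ≡ w
toWord-surjective []        = [] , refl
toWord-surjective (con c w) with toWord-surjective w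
... | u , eq = c ∷ u , cong (con c) eq

-- The Hales-Jewett theorem for `m`-dimensional subspaces: each dimension is a line whose letter no
-- tail can detect, and the tails are treated recursively.
grahamRothschild-zero : GrahamRothschild 0
grahamRothschild-zero zero    zero    = 0 , λ χ → [] , χ [] , λ { [] → refl }
grahamRothschild-zero zero    (suc m) = suc m , λ χ → identity _ , true , λ { (con () _) }
grahamRothschild-zero (suc a) zero    = 0 , λ χ → [] , χ [] , λ { [] → refl }
grahamRothschild-zero (suc a) (suc m) with grahamRothschild-zero (suc a) m
... | n₂ , ih with halesJewett-Bool (suc a) (suc a ^ n₂)
... | n₁ , hj = n₁ + n₂ , step
  where
  step : (χ : Word (suc a) 0 (n₁ + n₂) → Bool) →
         Σ[ h ∈ Word (suc a) (suc m) (n₁ + n₂) ] Homogeneous χ h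
  step χ with hj (λ u i → χ (prepend u (toWord (decode i))))
  ... | L , p , indep with ih (λ w → χ (prepend (fill L zero) w))
  ... | h , c , hom = attach L p h , c , λ { (con x g) → begin
      χ (attach L p h ∙ con x g)         ≡⟨ cong χ (attach-∙-con L p h x g) ⟩
      χ (prepend (fill L x) (h ∙ g))    ≡⟨ indep′ x (h ∙ g) ⟩
      χ (prepend (fill L zero) (h ∙ g)) ≡⟨ hom g ⟩
      c                                  ∎ }
    where
    open ≡-Reasoning
    indep′ : ∀ x w → χ (prepend (fill L x) w) ≡ χ (prepend (fill L zero) w)
    indep′ x w with toWord-surjective w
    ... | u , refl = subst
      (λ u → χ (prepend (fill L x) (toWord u)) ≡ χ (prepend (fill L zero) (toWord u)))
      (decode-encode u) (indep x zero (encode u))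

-- A word that begins with its first parameter continues with `k` parameters over one more letter,
-- so the theorem for `k` fixes its colour. Words that begin with a letter `x` are left to the
-- recursion, with one colouring per index and letter; hence a family of `s` colourings.
colour-by-initial : ∀ {k} → GrahamRothschild k → ∀ m a s →
  ∃[ n ] ((χ : Fin s → Word a (suc k) n → Bool) →
    Σ[ h ∈ Word a m n ] Σ[ c ∈ (Fin s → List (Fin a) → Bool) ]
      (∀ i g → χ i (h ∙ g) ≡ c i (initial g)))
colour-by-initial gr zero    a s = 0 , λ χ → [] , (λ _ _ → true) , λ i ()
colour-by-initial {k} gr (suc m) a s with colour-by-initial gr m a (s * a)
... | n₂ , ih with simultaneous-Fin gr s (suc a) n₂
... | n₁ , gr₁ = suc n₁ , step
  where
  step : (χ : Fin s → Word a (suc k) (suc n₁) → Bool) →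
    Σ[ h ∈ Word a (suc m) (suc n₁) ] Σ[ c ∈ (Fin s → List (Fin a) → Bool) ]
      (∀ i g → χ i (h ∙ g) ≡ c i (initial g))
  step χ with gr₁ (λ i g → χ i (new g))
  ... | h₁ , hom = result (ih (λ j → χ₂ (remQuot a j)))
    where
    χ₂ : Fin s × Fin a → Word a (suc k) n₂ → Bool
    χ₂ (i , x) g = χ i (con x (compose h₁ (x ∷ allFin a) g))

    result : Σ[ h ∈ Word a m n₂ ] Σ[ c ∈ (Fin (s * a) → List (Fin a) → Bool) ]
               (∀ j g → χ₂ (remQuot a j) (h ∙ g) ≡ c j (initial g)) →
             Σ[ h ∈ Word a (suc m) (suc n₁) ] Σ[ c ∈ (Fin s → List (Fin a) → Bool) ]
               (∀ i g → χ i (h ∙ g) ≡ c i (initial g))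
    result (h₂ , c₂ , by-initial) = new (h₁ ∙ weaken h₂) , c , by-initial′
      where
      c : Fin s → List (Fin a) → Bool
      c i []      = proj₁ (hom i)
      c i (x ∷ p) = c₂ (combine i x) p

      by-initial′ : ∀ i g → χ i (new (h₁ ∙ weaken h₂) ∙ g) ≡ c i (initial g)
      by-initial′ i (new g) = trans
        (cong (χ i) (trans (∙-new (h₁ ∙ weaken h₂) g) (cong new (∙-assoc h₁ (weaken h₂) g))))
        (proj₂ (hom i) (weaken h₂ ∙ g))
      by-initial′ i (con x g) = begin
        χ i (con x (compose (h₁ ∙ weaken h₂) (x ∷ allFin a) g))
          ≡⟨ cong (λ w → χ i (con x w)) (compose-assoc h₁ _ (weaken h₂) _ g) ⟩
        χ i (con x (compose h₁ (map (lookup (x ∷ allFin a)) (allFin (suc a)))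
                           (compose (weaken h₂) (x ∷ allFin a) g)))
          ≡⟨ cong₂ (λ σ w → χ i (con x (compose h₁ σ w)))
                   (map-lookup-allFin (x ∷ allFin a)) (compose-weaken h₂ x (allFin a) g) ⟩
        χ₂ (i , x) (h₂ ∙ g)
          ≡⟨ cong (λ ix → χ₂ ix (h₂ ∙ g)) (Finₚ.remQuot-combine i x) ⟨
        χ₂ (remQuot a (combine i x)) (h₂ ∙ g)
          ≡⟨ by-initial (combine i x) g ⟩
        c₂ (combine i x) (initial g) ∎
        where open ≡-Reasoning

-- Each position is replaced by a line along which the letter does not affect the colour of any
-- continuation, so only the place where the initial segment ends remains visible.
colour-by-length : ∀ a k m → ∃[ n ] ((c : List (Fin (suc a)) → Bool) →
  Σ[ h ∈ Word (suc a) m n ] Σ[ d ∈ (ℕ → Bool) ]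
    (∀ (g : Word (suc a) (suc k) m) → c (initial (h ∙ g)) ≡ d (length (initial g))))
colour-by-length a k zero = 0 , λ c → [] , (λ _ → true) , λ ()
colour-by-length a k (suc m) with colour-by-length a k m
... | n₂ , ih with halesJewett-Bool (suc a) (suc (suc a) ^ n₂)
... | n₁ , hj = n₁ + n₂ , step
  where
  step : (c : List (Fin (suc a)) → Bool) →
    Σ[ h ∈ Word (suc a) (suc m) (n₁ + n₂) ] Σ[ d ∈ (ℕ → Bool) ]
      (∀ (g : Word (suc a) (suc k) (suc m)) → c (initial (h ∙ g)) ≡ d (length (initial g)))
  step c with hj (λ u i → c (toList u List.++ stop (decode i)))
  ... | L , p , indep with ih (λ q → c (toList (fill L zero) List.++ q))
  ... | h , d , by-length = attach L p h , d′ , by-length′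
    where
    d′ : ℕ → Bool
    d′ zero    = c (List.map (lookup (allFin _)) (lead L))
    d′ (suc l) = d l

    indep′ : ∀ x (g : Word (suc a) (suc k) n₂) →
             c (toList (fill L x) List.++ initial g) ≡ c (toList (fill L zero) List.++ initial g)
    indep′ x g with stop-surjective g
    ... | u , eq = subst
      (λ q → c (toList (fill L x) List.++ q) ≡ c (toList (fill L zero) List.++ q))
      (trans (cong stop (decode-encode u)) eq)
      (indep x zero (encode u))

    by-length′ : ∀ g → c (initial (attach L p h ∙ g)) ≡ d′ (length (initial g))
    by-length′ (new g)   = cong c (initial-attach-new L p h (allFin _) g)
    by-length′ (con x g) = begin
      c (initial (attach L p h ∙ con x g))
        ≡⟨ cong (λ w → c (initial w)) (attach-∙-con L p h x g) ⟩
      c (initial (prepend (fill L x) (h ∙ g)))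
        ≡⟨ cong c (initial-prepend (fill L x) (h ∙ g)) ⟩
      c (toList (fill L x) List.++ initial (h ∙ g))
        ≡⟨ indep′ x (h ∙ g) ⟩
      c (toList (fill L zero) List.++ initial (h ∙ g))
        ≡⟨ by-length g ⟩
      d (length (initial g)) ∎
      where open ≡-Reasoning

ConstantLength : ∀ {a m n} → ℕ → (ℕ → Bool) → Bool → Word a m n → Set
ConstantLength {a} {m} k d x h = ∀ {b} (σ : Vec (Fin b) a) (g : Word b (suc k) m) →
  d (length (initial (compose h σ g))) ≡ x

constantLength-new : ∀ {a m n k d x} {h : Word a m n} → d 0 ≡ x →
  ConstantLength k (d ∘ suc) x h → ConstantLength k d x (new (weaken h))
constantLength-new         d0 const σ (new g)   = d0
constantLength-new {d = d} {h = h} d0 const σ (con x g) =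
  trans (cong (λ w → d (suc (length (initial w)))) (compose-weaken h x σ g)) (const σ g)

-- The first parameter of a composite stands where `h` has one of its parameters. So `h` puts its
-- parameters at positions on which `d` has one fixed value, and letter `zero` elsewhere.
pigeonhole : ∀ {a} k N m₁ m₂ → N ≡ m₁ + m₂ → (d : ℕ → Bool) →
  (Σ[ h ∈ Word (suc a) m₁ N ] ConstantLength k d true h) ⊎
  (Σ[ h ∈ Word (suc a) m₂ N ] ConstantLength k d false h)
pigeonhole k N       zero     m₂       eq d = inj₁ (toWord (replicate N zero) , λ σ ())
pigeonhole k N       (suc m₁) zero     eq d = inj₂ (toWord (replicate N zero) , λ σ ())
pigeonhole k (suc N) (suc m₁) (suc m₂) eq d with d 0 in d0
... | true  with pigeonhole k N m₁ (suc m₂) (ℕₚ.suc-injective eq) (d ∘ suc)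
...   | inj₁ (h , const) = inj₁ (new (weaken h) , constantLength-new {d = d} {h = h} d0 const)
...   | inj₂ (h , const) = inj₂ (con zero h , const)
pigeonhole k (suc N) (suc m₁) (suc m₂) eq d | false
  with pigeonhole k N (suc m₁) m₂ (trans (ℕₚ.suc-injective eq) (ℕₚ.+-suc m₁ m₂)) (d ∘ suc)
...   | inj₁ (h , const) = inj₁ (con zero h , const)
...   | inj₂ (h , const) = inj₂ (new (weaken h) , constantLength-new {d = d} {h = h} d0 const)

-- Three passages to subwords make the colour depend on the initial segment, then on its length,
-- then on nothing. Over the empty alphabet the initial segment is empty and the first passage
-- suffices.
grahamRothschild-suc : ∀ k → GrahamRothschild k → GrahamRothschild (suc k)
grahamRothschild-suc k gr zero m with colour-by-initial gr m 0 1
... | n , by-initial = n , λ χ → result {χ} (by-initial (λ _ → χ))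
  where
  result : {χ : Word 0 (suc k) n → Bool} →
    Σ[ h ∈ Word 0 m n ] Σ[ c ∈ (Fin 1 → List (Fin 0) → Bool) ]
      (∀ i g → χ (h ∙ g) ≡ c i (initial g)) → Σ[ h ∈ Word 0 m n ] Homogeneous χ h
  result (h , c , eq) = h , c zero [] , λ { (con () _) ; g@(new _) → eq zero g }
grahamRothschild-suc k gr (suc a) m with colour-by-length a k (m + m)
... | n₂ , by-length with colour-by-initial gr n₂ (suc a) 1
... | n₁ , by-initial = n₁ , step
  where
  step : (χ : Word (suc a) (suc k) n₁ → Bool) → Σ[ h ∈ Word (suc a) m n₁ ] Homogeneous χ h
  step χ with by-initial (λ _ → χ)
  ... | h₁ , c , eq₁ with by-length (c zero)
  ... | h₂ , d , eq₂ = result (pigeonhole k (m + m) m m refl d)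
    where
    homogeneous : ∀ {x} (h : Word (suc a) m (m + m)) → ConstantLength k d x h →
                  Homogeneous χ (h₁ ∙ (h₂ ∙ h))
    homogeneous {x} h const = x , λ g → begin
      χ ((h₁ ∙ (h₂ ∙ h)) ∙ g)                ≡⟨ cong χ (∙-assoc h₁ (h₂ ∙ h) g) ⟩
      χ (h₁ ∙ ((h₂ ∙ h) ∙ g))                ≡⟨ eq₁ zero ((h₂ ∙ h) ∙ g) ⟩
      c zero (initial ((h₂ ∙ h) ∙ g))        ≡⟨ cong (λ w → c zero (initial w)) (∙-assoc h₂ h g) ⟩
      c zero (initial (h₂ ∙ (h ∙ g)))        ≡⟨ eq₂ (h ∙ g) ⟩
      d (length (initial (h ∙ g)))           ≡⟨ const (allFin _) g ⟩
      x                                      ∎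
      where open ≡-Reasoning

    result : (Σ[ h ∈ Word (suc a) m (m + m) ] ConstantLength k d true h) ⊎
             (Σ[ h ∈ Word (suc a) m (m + m) ] ConstantLength k d false h) →
             Σ[ h ∈ Word (suc a) m n₁ ] Homogeneous χ h
    result (inj₁ (h , const)) = _ , homogeneous h const
    result (inj₂ (h , const)) = _ , homogeneous h const

grahamRothschild : ∀ k → GrahamRothschild k
grahamRothschild zero    = grahamRothschild-zero
grahamRothschild (suc k) = grahamRothschild-suc k (grahamRothschild k)

-- Ramsey theorem for ordered graphs

data Thinning : ℕ → ℕ → Set where
  done : Thinning 0 0
  keep : ∀ {n N} → Thinning n N → Thinning (suc n) (suc N)
  skip : ∀ {n N} → Thinning n N → Thinning n (suc N)

embed : ∀ {n N} → Thinning n N → Fin n → Fin N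
embed (keep θ) zero    = zero
embed (keep θ) (suc i) = suc (embed θ i)
embed (skip θ) i       = suc (embed θ i)

interleave : ∀ {B : Set} {n} → Vec (B × B) n → Vec B (n * 2)
interleave []            = []
interleave ((x , y) ∷ v) = x ∷ y ∷ interleave v

-- Letters are listed with the most recent parameter first, so the pairs are reversed.
interleaveLetters : ∀ {B : Set} {n} → Vec (B × B) n → Vec B (n * 2)
interleaveLetters []            = []
interleaveLetters ((x , y) ∷ ρ) = y ∷ x ∷ interleaveLetters ρ

first second : ∀ {n} → Fin n → Fin (n * 2)
first zero     = suc zero
first (suc i)  = suc (suc (first i))
second zero    = zero
second (suc i) = suc (suc (second i))

lookup-first : ∀ {B : Set} {n} (ρ : Vec (B × B) n) c →
               lookup (interleaveLetters ρ) (first c) ≡ proj₁ (lookup ρ c)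
lookup-first (_ ∷ ρ) zero    = refl
lookup-first (_ ∷ ρ) (suc c) = lookup-first ρ c

lookup-second : ∀ {B : Set} {n} (ρ : Vec (B × B) n) c →
                lookup (interleaveLetters ρ) (second c) ≡ proj₂ (lookup ρ c)
lookup-second (_ ∷ ρ) zero    = refl
lookup-second (_ ∷ ρ) (suc c) = lookup-second ρ c

-- Models a vertex that is kept: it splits each subset into one without it and one with it, whose
-- traces differ.
double : ∀ {a k n} → Word a k n → Word (a * 2) (k * 2) (n * 2)
double []        = []
double (con c w) = con (first c) (con (second c) (double w))
double (new w)   = new (new (double w))

-- Models a vertex that is skipped: the list of subsets still doubles, but both halves of a pair
-- have the same trace.
repeat : ∀ {a k n} → Word a k n → Word a k (n * 2)
repeat []        = []
repeat (con c w) = con c (con c (repeat w))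
repeat (new w)   = new (con zero (repeat w))

dup : ∀ {B : Set} → B → B × B
dup x = x , x

expand-double : ∀ {a k n} {B : Set} (w : Word a k n) (ρ : Vec (B × B) a) (A : Vec (B × B) k) →
                expand (double w) (interleaveLetters ρ) (interleave A) ≡ interleave (expand w ρ A)
expand-double []        ρ []            = refl
expand-double (con c w) ρ A             =
  cong₂ _∷_ (lookup-first ρ c) (cong₂ _∷_ (lookup-second ρ c) (expand-double w ρ A))
expand-double (new w)   ρ ((x , y) ∷ A) = cong (λ v → x ∷ y ∷ v) (expand-double w ((x , y) ∷ ρ) A)

expand-repeat : ∀ {a k n} {B : Set} (w : Word a k n) (ρ : Vec B a) (A : Vec B k) →
                expand (repeat w) ρ A ≡ interleave (map dup (expand w ρ A))
expand-repeat []        ρ []      = refl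
expand-repeat (con c w) ρ A       = cong (λ v → _ ∷ _ ∷ v) (expand-repeat w ρ A)
expand-repeat (new w)   ρ (x ∷ A) = cong (λ v → x ∷ x ∷ v) (expand-repeat w (x ∷ ρ) A)

expand-map : ∀ {a k n} {B C : Set} (f : B → C) (w : Word a k n) (ρ : Vec B a) (A : Vec B k) →
             expand w (map f ρ) (map f A) ≡ map f (expand w ρ A)
expand-map f []        ρ []      = refl
expand-map f (con c w) ρ A       = cong₂ _∷_ (Vecₚ.lookup-map c f ρ) (expand-map f w ρ A)
expand-map f (new w)   ρ (x ∷ A) = cong (f x ∷_) (expand-map f w (x ∷ ρ) A)

expand-replicate : ∀ {a k n} {B : Set} (w : Word a k n) (x : B) →
                   expand w (replicate a x) (replicate k x) ≡ replicate n x
expand-replicate []            x = refl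
expand-replicate {a} (con c w) x = cong₂ _∷_ (Vecₚ.lookup-replicate c x) (expand-replicate w x)
expand-replicate (new w)       x = cong (x ∷_) (expand-replicate w x)

cube : ℕ → ℕ
cube zero    = 1
cube (suc n) = cube n * 2

-- Membership of i in the subsets of Fin n, enumerated in colexicographic order.
containing : ∀ {n} → Fin n → Vec Bool (cube n)
containing {suc n} zero    = interleave (replicate (cube n) (false , true))
containing {suc n} (suc i) = interleave (map dup (containing i))

even odd : ∀ {n} → Fin n → Fin (n * 2)
even zero    = zero
even (suc i) = suc (suc (even i))
odd zero     = suc zero
odd (suc i)  = suc (suc (odd i))

lookup-even : ∀ {B : Set} {n} (v : Vec (B × B) n) c → lookup (interleave v) (even c) ≡ proj₁ (lookup v c)
lookup-even (_ ∷ v) zero    = refl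
lookup-even (_ ∷ v) (suc c) = lookup-even v c

lookup-odd : ∀ {B : Set} {n} (v : Vec (B × B) n) c → lookup (interleave v) (odd c) ≡ proj₂ (lookup v c)
lookup-odd (_ ∷ v) zero    = refl
lookup-odd (_ ∷ v) (suc c) = lookup-odd v c

subset : ∀ {n} (r : Fin n → Bool) → ∃[ c ] (∀ i → lookup (containing i) c ≡ r i)
subset {zero}  r = zero , λ ()
subset {suc n} r with subset (r ∘ suc) | r zero in r₀
... | c , eq | false = even c , λ
  { zero    → trans (lookup-even (replicate (cube n) (false , true)) c)
             (trans (cong proj₁ (Vecₚ.lookup-replicate c (false , true))) (sym r₀))
  ; (suc i) → trans (lookup-even (map dup (containing i)) c)
             (trans (cong proj₁ (Vecₚ.lookup-map c dup (containing i))) (eq i)) }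
... | c , eq | true = odd c , λ
  { zero    → trans (lookup-odd (replicate (cube n) (false , true)) c)
             (trans (cong proj₂ (Vecₚ.lookup-replicate c (false , true))) (sym r₀))
  ; (suc i) → trans (lookup-odd (map dup (containing i)) c)
             (trans (cong proj₂ (Vecₚ.lookup-map c dup (containing i))) (eq i)) }

-- The restriction of subsets of Fin N along a thinning.  Colexicographic order makes the
-- traces of the subsets appear for the first time in their own colexicographic order.
restrict : ∀ {n N} → Thinning n N → Word 0 (cube n) (cube N)
restrict done     = new []
restrict (keep θ) = double (restrict θ)
restrict (skip θ) = repeat (restrict θ)

expand-restrict : ∀ {n N} (θ : Thinning n N) i →
                  expand (restrict θ) [] (containing i) ≡ containing (embed θ i)
expand-restrict (keep θ) zero    = trans
  (expand-double (restrict θ) [] (replicate _ (false , true)))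
  (cong interleave (expand-replicate (restrict θ) (false , true)))
expand-restrict (keep θ) (suc i) = trans (expand-double (restrict θ) [] (map dup (containing i)))
  (cong interleave (trans (expand-map dup (restrict θ) [] (containing i))
                          (cong (map dup) (expand-restrict θ i))))
expand-restrict (skip θ) i       = trans (expand-repeat (restrict θ) [] (containing i))
  (cong (λ v → interleave (map dup v)) (expand-restrict θ i))

infixl 6 _+ʳ_
-- Addition by accumulation matches how `new` enlarges the alphabet, so `_followedBy_` needs no
-- transport.
_+ʳ_ : ℕ → ℕ → ℕ
a +ʳ zero  = a
a +ʳ suc k = suc a +ʳ k

_followedBy_ : ∀ {a k l m n} → Word a k m → Word (a +ʳ k) l n → Word a (k + l) (m + n)
[]      followedBy w′ = w′
con c w followedBy w′ = con c (w followedBy w′)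
new w   followedBy w′ = new (w followedBy w′)

letters : ∀ {B : Set} {a k} → Vec B a → Vec B k → Vec B (a +ʳ k)
letters ρ []      = ρ
letters ρ (x ∷ A) = letters (x ∷ ρ) A

oldLetter : ∀ {a} k → Fin a → Fin (a +ʳ k)
oldLetter zero    c = c
oldLetter (suc k) c = oldLetter k (suc c)

parameter : ∀ {a k} → Fin k → Fin (a +ʳ k)
parameter {k = suc k} zero    = oldLetter k zero
parameter             (suc j) = parameter j

lookup-oldLetter : ∀ {B : Set} {a k} (ρ : Vec B a) (A : Vec B k) c →
                   lookup (letters ρ A) (oldLetter k c) ≡ lookup ρ c
lookup-oldLetter ρ []      c = refl
lookup-oldLetter ρ (x ∷ A) c = lookup-oldLetter (x ∷ ρ) A (suc c)

lookup-parameter : ∀ {B : Set} {a k} (ρ : Vec B a) (A : Vec B k) j →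
                   lookup (letters ρ A) (parameter j) ≡ lookup A j
lookup-parameter ρ (x ∷ A) zero    = lookup-oldLetter (x ∷ ρ) A zero
lookup-parameter ρ (x ∷ A) (suc j) = lookup-parameter (x ∷ ρ) A j

expand-followedBy : ∀ {B : Set} {a k l m n} (w : Word a k m) (w′ : Word (a +ʳ k) l n)
                    (ρ : Vec B a) (A : Vec B k) (A′ : Vec B l) →
                    expand (w followedBy w′) ρ (A ++ A′) ≡ expand w ρ A ++ expand w′ (letters ρ A) A′
expand-followedBy []        w′ ρ []      A′ = refl
expand-followedBy (con c w) w′ ρ A       A′ = cong (_ ∷_) (expand-followedBy w w′ ρ A A′)
expand-followedBy (new w)   w′ ρ (x ∷ A) A′ = cong (x ∷_) (expand-followedBy w w′ (x ∷ ρ) A A′)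

pos-followedBy : ∀ {a k l m n} (w : Word a k m) (w′ : Word (a +ʳ k) l n) j →
                 pos (w followedBy w′) (k ↑ʳ j) ≡ m ↑ʳ pos w′ j
pos-followedBy []        w′ j = refl
pos-followedBy (con c w) w′ j = cong suc (pos-followedBy w w′ j)
pos-followedBy (new w)   w′ j = cong suc (pos-followedBy w w′ j)

select : ∀ {a n N} → Thinning n N → (Fin N → Fin a) → Word a n N
select done     cs = []
-- The left `suc` shifts letters past the new parameter; the right one moves to the next position.
select (keep θ) cs = new (select θ (suc ∘ cs ∘ suc))
select (skip θ) cs = con (cs zero) (select θ (cs ∘ suc))

expand-select : ∀ {B : Set} {a n N} (θ : Thinning n N) (cs : Fin N → Fin a)
                (ρ : Vec B a) (A : Vec B n) (E : Vec B N) →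
                (∀ v → lookup ρ (cs v) ≡ lookup E v) →
                (∀ j → lookup A j ≡ lookup E (embed θ j)) →
                expand (select θ cs) ρ A ≡ E
expand-select done     cs ρ []      []      old chosen = refl
expand-select (keep θ) cs ρ (x ∷ A) (y ∷ E) old chosen =
  cong₂ _∷_ (chosen zero) (expand-select θ _ (x ∷ ρ) A E (old ∘ suc) (chosen ∘ suc))
expand-select (skip θ) cs ρ A       (y ∷ E) old chosen =
  cong₂ _∷_ (old zero) (expand-select θ _ ρ A E (old ∘ suc) chosen)

pos-select : ∀ {a n N} (θ : Thinning n N) (cs : Fin N → Fin a) j → pos (select θ cs) j ≡ embed θ j
pos-select (keep θ) cs zero    = refl
pos-select (keep θ) cs (suc j) = cong suc (pos-select θ _ j)
pos-select (skip θ) cs j       = cong suc (pos-select θ _ j)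

-- The vertex v is coded by a set: the subsets of vertices containing v, followed by the
-- neighbours of v.
vertexSet : ∀ {N} → (Fin N → Fin N → Bool) → Fin N → Vec Bool (cube N + N)
vertexSet E v = containing v ++ tabulate (E v)

-- Listing all subsets of vertices first makes the words of any two copies of the same
-- graph have the same parameters: the trace of a neighbourhood is always an old letter.
subgraphWord : ∀ {n N} → (Fin N → Fin N → Bool) → Thinning n N → Word 0 (cube n + n) (cube N + N)
subgraphWord E θ = restrict θ followedBy select θ (λ v → parameter (proj₁ (subset (λ i → E (embed θ i) v))))

-- At an omitted vertex `v` the word repeats the parameter named by the trace of the neighbourhood
-- of `v`. In the set of `i` its value says whether `i` is in that trace, that is, whether
-- `embed θ i` is adjacent to `v`.
expand-subgraphWord : ∀ {n N} (E : Fin N → Fin N → Bool) (F : Fin n → Fin n → Bool) (θ : Thinning n N) →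
  (∀ i j → E (embed θ i) (embed θ j) ≡ F i j) → ∀ i →
  expand (subgraphWord E θ) [] (vertexSet F i) ≡ vertexSet E (embed θ i)
expand-subgraphWord E F θ copy i = trans
  (expand-followedBy (restrict θ) (select θ _) [] (containing i) (tabulate (F i)))
  (cong₂ _++_ (expand-restrict θ i)
    (expand-select θ _ (letters [] (containing i)) (tabulate (F i)) (tabulate (E (embed θ i)))
      (λ v → trans (lookup-parameter [] (containing i) _)
            (trans (proj₂ (subset (λ i → E (embed θ i) v)) i)
                   (sym (Vecₚ.lookup∘tabulate (E (embed θ i)) v))))
      (λ j → trans (Vecₚ.lookup∘tabulate (F i) j)
            (trans (sym (copy i j)) (sym (Vecₚ.lookup∘tabulate (E (embed θ i)) (embed θ j)))))))

pos-subgraphWord : ∀ {n N} (E : Fin N → Fin N → Bool) (θ : Thinning n N) i →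
                   pos (subgraphWord E θ) (cube n ↑ʳ i) ≡ cube N ↑ʳ embed θ i
pos-subgraphWord E θ i = trans (pos-followedBy (restrict θ) (select θ _) i) (cong (_ ↑ʳ_) (pos-select θ _ i))

-- The universal bipartite graph, between the subsets and the elements of Fin N′, replaces a
-- Ramsey ordered graph: a vertex of E is a pair, and adjacency is membership.
UniformCopy : ∀ {ℓ} {T : Set ℓ} (n : T → ℕ) (F : ∀ t → Fin (n t) → Fin (n t) → Bool)
  (ts : List T) {N : ℕ} (E : Fin N → Fin N → Bool) {N′ : ℕ}
  (χ : ∀ t → Vec (Vec Bool N′ × Fin N′) (n t) → Bool) → Set ℓ
UniformCopy n F ts {N} E {N′} χ = Σ[ A ∈ (Fin N → Vec Bool N′ × Fin N′) ]
  (∀ v w → lookup (proj₁ (A v)) (proj₂ (A w)) ≡ E v w) ×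
  (∀ {t} → t ∈ᴸ ts → ∃[ c ] (∀ (θ : Thinning (n t) N) →
    (∀ i j → E (embed θ i) (embed θ j) ≡ F t i j) → χ t (tabulate (A ∘ embed θ)) ≡ c))

-- Colours of coded tuples are pulled back to parameter words. A copy of `F t` in `E` is coded by
-- `h ∙ subgraphWord E θ`, so homogeneity of `h` fixes its colour.
orderedGraphRamsey : ∀ {ℓ} {T : Set ℓ} (n : T → ℕ) (F : ∀ t → Fin (n t) → Fin (n t) → Bool)
  (ts : List T) (N : ℕ) (E : Fin N → Fin N → Bool) →
  ∃[ N′ ] ((χ : ∀ t → Vec (Vec Bool N′ × Fin N′) (n t) → Bool) → UniformCopy n F ts E χ)
orderedGraphRamsey {T = T} n F ts N E
  with simultaneous (λ t → cube (n t) + n t) (λ t → grahamRothschild _) 0 (cube N + N) ts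
... | N′ , ramsey = N′ , step
  where
  pair : ∀ {n} → (Fin n → Fin n → Bool) → Word 0 (cube n + n) N′ → Fin n → Vec Bool N′ × Fin N′
  pair {n} F w i = expand w [] (vertexSet F i) , pos w (cube n ↑ʳ i)

  step : (χ : ∀ t → Vec (Vec Bool N′ × Fin N′) (n t) → Bool) → UniformCopy n F ts E χ
  step χ with ramsey (λ t w → χ t (tabulate (pair (F t) w)))
  ... | h , homogeneous = pair E h , edges , λ {t} t∈ → proj₁ (homogeneous t∈) , λ θ copy →
    trans (cong (χ t) (Vecₚ.tabulate-cong (λ i → sym (pair-subgraph t θ copy i))))
          (proj₂ (homogeneous t∈) (subgraphWord E θ))
    where
    edges : ∀ v w → lookup (expand h [] (vertexSet E v)) (pos h (cube N ↑ʳ w)) ≡ E v w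
    edges v w = trans (lookup-expand-pos h [] (vertexSet E v) (cube N ↑ʳ w))
               (trans (Vecₚ.lookup-++ʳ (containing v) _ w) (Vecₚ.lookup∘tabulate (E v) w))

    pair-subgraph : ∀ t (θ : Thinning (n t) N) → (∀ i j → E (embed θ i) (embed θ j) ≡ F t i j) → ∀ i →
                    pair (F t) (h ∙ subgraphWord E θ) i ≡ pair E h (embed θ i)
    pair-subgraph t θ copy i = cong₂ _,_
      (trans (expand-∙ h (subgraphWord E θ) [] (vertexSet (F t) i))
             (cong (expand h []) (expand-subgraphWord E (F t) θ copy i)))
      (trans (pos-compose h _ (subgraphWord E θ) _) (cong (pos h) (pos-subgraphWord E θ i)))

-- Ultrafilters

-- Bool-valued subsets: under excluded middle they represent all subsets while staying in
-- the universe of the set.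
𝒫 : ∀ {ℓ} → Set ℓ → Set ℓ
𝒫 A = A → Bool

infix 4 _∈ₚ_ _⊆ₚ_
_∈ₚ_ : ∀ {ℓ} {A : Set ℓ} → A → 𝒫 A → Set
x ∈ₚ S = S x ≡ true

_⊆ₚ_ : ∀ {ℓ} {A : Set ℓ} → 𝒫 A → 𝒫 A → Set ℓ
S ⊆ₚ S′ = ∀ x → x ∈ₚ S → x ∈ₚ S′

module Decide {ℓ : Level} (em : ExcludedMiddle ℓ) where

  ⌊_⌋ : Set ℓ → Bool
  ⌊ P ⌋ = isYes (em {P})

  ⌊⌋-intro : ∀ {P} → P → ⌊ P ⌋ ≡ true
  ⌊⌋-intro {P} p with em {P}
  ... | yes _ = refl
  ... | no ¬p = contradiction p ¬p

  ⌊⌋-elim : ∀ {P} → ⌊ P ⌋ ≡ true → P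
  ⌊⌋-elim {P} eq with em {P}
  ... | yes p = p

module Classical {ℓ : Level} (em : ExcludedMiddle ℓ) (ext : Extensionality ℓ 0ℓ) where

  open Decide em public

  ⊆ₚ-antisym : ∀ {A : Set ℓ} {S S′ : 𝒫 A} → S ⊆ₚ S′ → S′ ⊆ₚ S → S ≡ S′
  ⊆ₚ-antisym {S = S} {S′} p q = ext λ x → pointwise x (S x) (S′ x) refl refl
    where
    pointwise : ∀ x b b′ → S x ≡ b → S′ x ≡ b′ → S x ≡ S′ x
    pointwise x true  b′    eq eq′ = trans eq (sym (p x eq))
    pointwise x false true  eq eq′ = trans (q x eq′) (sym eq′)
    pointwise x false false eq eq′ = trans eq (sym eq′)

  -- The Teichmüller–Tukey lemma: the increasing transfinite iteration of adding one
  -- element is a chain, so its union is maximal.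
  module Tukey {Z : Set ℓ} (ok : List Z → Set ℓ) (F₀ : 𝒫 Z) where

    Good : 𝒫 Z → Set ℓ
    Good F = ∀ zs → All (_∈ₚ F) zs → ok zs

    adjoin : 𝒫 Z → Z → 𝒫 Z
    adjoin F z y = ⌊ Lift ℓ (y ∈ₚ F) ⊎ y ≡ z ⌋

    Extendable : 𝒫 Z → Set ℓ
    Extendable F = Σ[ z ∈ Z ] ¬ (z ∈ₚ F) × Good (adjoin F z)

    -- Applied to the type of admissible new elements, `em` returns one if there is any, so it is
    -- also the choice function of the iteration.
    next : 𝒫 Z → 𝒫 Z
    next F with em {Extendable F}
    ... | yes (z , _) = adjoin F z
    ... | no _        = F

    ⊆-adjoin : ∀ F z → F ⊆ₚ adjoin F z
    ⊆-adjoin F z x x∈F = ⌊⌋-intro (inj₁ (lift x∈F))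

    ⊆-next : ∀ F → F ⊆ₚ next F
    ⊆-next F with em {Extendable F}
    ... | yes (z , _) = ⊆-adjoin F z
    ... | no _        = λ _ x∈F → x∈F

    ⋃ : 𝒫 (𝒫 Z) → 𝒫 Z
    ⋃ C z = ⌊ Lift ℓ (z ∈ₚ F₀) ⊎ Σ[ F ∈ 𝒫 Z ] F ∈ₚ C × z ∈ₚ F ⌋

    ⊆-⋃ : ∀ {C F} → F ∈ₚ C → F ⊆ₚ ⋃ C
    ⊆-⋃ F∈C z z∈F = ⌊⌋-intro (inj₂ (_ , F∈C , z∈F))

    ⋃-least : ∀ {C G} → F₀ ⊆ₚ G → (∀ F → F ∈ₚ C → F ⊆ₚ G) → ⋃ C ⊆ₚ G
    ⋃-least F₀⊆G C⊆G z z∈ with ⌊⌋-elim z∈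
    ... | inj₁ (lift z∈F₀)     = F₀⊆G z z∈F₀
    ... | inj₂ (F , F∈C , z∈F) = C⊆G F F∈C z z∈F

    data Tower : 𝒫 Z → Set ℓ where
      successor : ∀ {F} → Tower F → Tower (next F)
      union     : ∀ C → (∀ F → F ∈ₚ C → Tower F) → Tower (⋃ C)

    base : ∀ {F} → Tower F → F₀ ⊆ₚ F
    base (successor F∈T) z z∈ = ⊆-next _ z (base F∈T z z∈)
    base (union C C⊆T)   z z∈ = ⌊⌋-intro (inj₁ (lift z∈))

    -- Half of the Bourbaki-Witt argument: the last hypothesis makes `G` an extreme point. At a
    -- successor it excludes a jump over `G`; a union is above `next G` as soon as one member is.
    next-or-below : ∀ {F G} → Tower F → Tower G →
                    (∀ H → Tower H → H ⊆ₚ G → G ⊆ₚ H ⊎ next H ⊆ₚ G) → next G ⊆ₚ F ⊎ F ⊆ₚ G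
    next-or-below {G = G} (successor {F} F∈T) G∈T h with next-or-below F∈T G∈T h
    ... | inj₁ G⁺⊆F = inj₁ λ z z∈ → ⊆-next F z (G⁺⊆F z z∈)
    ... | inj₂ F⊆G with h F F∈T F⊆G
    ...   | inj₁ G⊆F  = inj₁ (subst (λ H → next G ⊆ₚ next H) (⊆ₚ-antisym G⊆F F⊆G) (λ _ z∈ → z∈))
    ...   | inj₂ F⁺⊆G = inj₂ F⁺⊆G
    next-or-below {G = G} (union C C⊆T) G∈T h with em {Σ[ F ∈ 𝒫 Z ] F ∈ₚ C × next G ⊆ₚ F}
    ... | yes (F , F∈C , G⁺⊆F) = inj₁ λ z z∈ → ⊆-⋃ F∈C z (G⁺⊆F z z∈)
    ... | no none = inj₂ (⋃-least (base G∈T) below)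
      where
      below : ∀ F → F ∈ₚ C → F ⊆ₚ G
      below F F∈C with next-or-below (C⊆T F F∈C) G∈T h
      ... | inj₁ G⁺⊆F = contradiction (F , F∈C , G⁺⊆F) none
      ... | inj₂ F⊆G  = F⊆G

    -- The other half: all tower members are extreme. If a union is not below `F`, some member `H`
    -- of it is not, and `H` is extreme by induction.
    equal-or-next : ∀ {G} → Tower G → ∀ F → Tower F → F ⊆ₚ G → G ⊆ₚ F ⊎ next F ⊆ₚ G
    equal-or-next (successor {G} G∈T) F F∈T F⊆G⁺ with next-or-below F∈T G∈T (equal-or-next G∈T)
    ... | inj₁ G⁺⊆F = inj₁ G⁺⊆F
    ... | inj₂ F⊆G with equal-or-next G∈T F F∈T F⊆G
    ...   | inj₁ G⊆F  = inj₂ (subst (λ H → next F ⊆ₚ next H) (⊆ₚ-antisym F⊆G G⊆F) (λ _ z∈ → z∈))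
    ...   | inj₂ F⁺⊆G = inj₂ λ z z∈ → ⊆-next G z (F⁺⊆G z z∈)
    equal-or-next (union C C⊆T) F F∈T F⊆⋃ with em {Σ[ H ∈ 𝒫 Z ] H ∈ₚ C × ¬ (H ⊆ₚ F)}
    ... | no none = inj₁ (⋃-least (base F∈T)
                     λ H H∈C → decidable-stable em λ H⊈F → none (H , H∈C , H⊈F))
    ... | yes (H , H∈C , H⊈F) with next-or-below F∈T (C⊆T H H∈C) (equal-or-next (C⊆T H H∈C))
    ...   | inj₁ H⁺⊆F = contradiction (λ z z∈ → H⁺⊆F z (⊆-next H z z∈)) H⊈F
    ...   | inj₂ F⊆H with equal-or-next (C⊆T H H∈C) F F∈T F⊆H
    ...     | inj₁ H⊆F  = contradiction H⊆F H⊈F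
    ...     | inj₂ F⁺⊆H = inj₂ λ z z∈ → ⊆-⋃ H∈C z (F⁺⊆H z z∈)

    chain : ∀ {F G} → Tower F → Tower G → G ⊆ₚ F ⊎ F ⊆ₚ G
    chain {G = G} F∈T G∈T with next-or-below F∈T G∈T (equal-or-next G∈T)
    ... | inj₁ G⁺⊆F = inj₁ λ z z∈ → G⁺⊆F z (⊆-next G z z∈)
    ... | inj₂ F⊆G  = inj₂ F⊆G

    module _ (F₀-good : Good F₀) where

      directed : ∀ {C} → (∀ F → F ∈ₚ C → Tower F) → ∀ zs → All (_∈ₚ ⋃ C) zs →
                 All (_∈ₚ F₀) zs ⊎ Σ[ F ∈ 𝒫 Z ] F ∈ₚ C × All (_∈ₚ F) zs
      directed C⊆T []       []         = inj₁ []
      directed C⊆T (z ∷ zs) (z∈ ∷ zs∈) with ⌊⌋-elim z∈ | directed C⊆T zs zs∈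
      ... | inj₁ (lift z∈F₀)     | inj₁ zs∈F₀           = inj₁ (z∈F₀ ∷ zs∈F₀)
      ... | inj₁ (lift z∈F₀)     | inj₂ (F , F∈C , zs∈F) =
        inj₂ (F , F∈C , base (C⊆T F F∈C) z z∈F₀ ∷ zs∈F)
      ... | inj₂ (F , F∈C , z∈F) | inj₁ zs∈F₀           =
        inj₂ (F , F∈C , z∈F ∷ All.map (base (C⊆T F F∈C) _) zs∈F₀)
      ... | inj₂ (F , F∈C , z∈F) | inj₂ (G , G∈C , zs∈G) with chain (C⊆T F F∈C) (C⊆T G G∈C)
      ...   | inj₁ G⊆F = inj₂ (F , F∈C , z∈F ∷ All.map (G⊆F _) zs∈G)
      ...   | inj₂ F⊆G = inj₂ (G , G∈C , F⊆G z z∈F ∷ zs∈G)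

      good : ∀ {F} → Tower F → Good F
      good (successor {F} F∈T) with em {Extendable F}
      ... | yes (z , _ , F⁺-good) = F⁺-good
      ... | no _                  = good F∈T
      good (union C C⊆T) zs zs∈ with directed C⊆T zs zs∈
      ... | inj₁ zs∈F₀           = F₀-good zs zs∈F₀
      ... | inj₂ (F , F∈C , zs∈F) = good (C⊆T F F∈C) zs zs∈F

      top : 𝒫 Z
      top = ⋃ (λ F → ⌊ Tower F ⌋)

      top-tower : Tower top
      top-tower = union _ (λ F → ⌊⌋-elim)

      -- Being the union of the whole tower, `top` contains its own `next`, which would have an
      -- element outside `top` if any could be adjoined.
      top-maximal : ∀ z → Good (adjoin top z) → z ∈ₚ top
      top-maximal z adjoin-good with em {Lift ℓ (z ∈ₚ top)}
      ... | yes (lift z∈) = z∈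
      ... | no z∉ = ⊥-elim impossible
        where
        next⊆top : next top ⊆ₚ top
        next⊆top = ⊆-⋃ (⌊⌋-intro (successor top-tower))

        impossible : ⊥
        impossible with em {Extendable top} | next⊆top
        ... | yes (y , y∉ , _) | ⊆top = y∉ (⊆top y (⌊⌋-intro (inj₂ refl)))
        ... | no stuck         | _    = stuck (z , (λ z∈ → z∉ (lift z∈)) , adjoin-good)

  -- An ultrafilter on the finite lists over Y that contains, for each y, the set of the
  -- lists in which y occurs.
  module Ultrafilter (Y : Set ℓ) where

    X : Set ℓ
    X = List Y

    Meet : List (𝒫 X) → Set ℓ
    Meet zs = Σ[ x ∈ X ] All (x ∈ₚ_) zs

    cone : Y → 𝒫 X
    cone y x = ⌊ y ∈ᴸ x ⌋

    IsCone : 𝒫 X → Set ℓ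
    IsCone S = Σ[ y ∈ Y ] S ≡ cone y

    open Tukey Meet (λ S → ⌊ IsCone S ⌋)

    cones-good : Good (λ S → ⌊ IsCone S ⌋)
    cones-good zs zs∈ = meet zs zs∈ , contains zs zs∈ (λ y∈ → y∈)
      where
      meet : ∀ zs → All (_∈ₚ (λ S → ⌊ IsCone S ⌋)) zs → X
      meet []       []         = []
      meet (z ∷ zs) (z∈ ∷ zs∈) = proj₁ (⌊⌋-elim z∈) ∷ meet zs zs∈

      contains : ∀ zs zs∈ {x} → (∀ {y} → y ∈ᴸ meet zs zs∈ → y ∈ᴸ x) → All (x ∈ₚ_) zs
      contains []       []         ⊆x = []
      contains (z ∷ zs) (z∈ ∷ zs∈) {x} ⊆x =
        subst (x ∈ₚ_) (sym (proj₂ (⌊⌋-elim z∈))) (⌊⌋-intro (⊆x (hereᴸ refl)))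
        ∷ contains zs zs∈ (λ y∈ → ⊆x (thereᴸ y∈))

    𝒰 : 𝒫 (𝒫 X)
    𝒰 = top cones-good

    𝒰-good : Good 𝒰
    𝒰-good = good cones-good (top-tower cones-good)

    reduce : ∀ S zs → All (_∈ₚ adjoin 𝒰 S) zs →
             Σ[ zs′ ∈ List (𝒫 X) ] All (_∈ₚ 𝒰) zs′ ×
               (∀ x → x ∈ₚ S → All (x ∈ₚ_) zs′ → All (x ∈ₚ_) zs)
    reduce S []       []         = [] , [] , λ _ _ _ → []
    reduce S (z ∷ zs) (z∈ ∷ zs∈) with reduce S zs zs∈ | ⌊⌋-elim z∈
    ... | zs′ , zs′∈ , imp | inj₁ (lift z∈𝒰) =
      z ∷ zs′ , z∈𝒰 ∷ zs′∈ , λ { x x∈S (x∈z ∷ x∈zs′) → x∈z ∷ imp x x∈S x∈zs′ }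
    ... | zs′ , zs′∈ , imp | inj₂ refl =
      zs′ , zs′∈ , λ x x∈S x∈zs′ → x∈S ∷ imp x x∈S x∈zs′

    -- By maximality it suffices that adjoining `S` keeps finite intersections inhabited; a point
    -- common to `zs` and the remaining sets lies in `S` too.
    𝒰-closed : ∀ zs S → All (_∈ₚ 𝒰) zs → (∀ x → All (x ∈ₚ_) zs → x ∈ₚ S) → S ∈ₚ 𝒰
    𝒰-closed zs S zs∈ imp = top-maximal cones-good S λ ws ws∈ →
      let ws′ , ws′∈ , imp′ = reduce S ws ws∈
          x , x∈ = 𝒰-good (zs List.++ ws′) (Allₚ.++⁺ zs∈ ws′∈)
      in x , imp′ x (imp x (Allₚ.++⁻ˡ zs x∈)) (Allₚ.++⁻ʳ zs x∈)

    record Large (P : X → Set ℓ) : Set where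
      constructor large
      field holds : (λ x → ⌊ P x ⌋) ∈ₚ 𝒰

    large-map : ∀ {P Q : X → Set ℓ} → (∀ x → P x → Q x) → Large P → Large Q
    large-map P⊆Q (large p) = large (𝒰-closed (_ ∷ []) _ (p ∷ [])
      λ { x (x∈ ∷ []) → ⌊⌋-intro (P⊆Q x (⌊⌋-elim x∈)) })

    large-zip : ∀ {P Q R : X → Set ℓ} → (∀ x → P x → Q x → R x) → Large P → Large Q → Large R
    large-zip PQ⊆R (large p) (large q) = large (𝒰-closed (_ ∷ _ ∷ []) _ (p ∷ q ∷ [])
      λ { x (x∈P ∷ x∈Q ∷ []) → ⌊⌋-intro (PQ⊆R x (⌊⌋-elim x∈P) (⌊⌋-elim x∈Q)) })

    large-all : ∀ {P : X → Set ℓ} → (∀ x → P x) → Large P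
    large-all p = large (𝒰-closed [] _ [] λ x _ → ⌊⌋-intro (p x))

    large-cone : ∀ {P : X → Set ℓ} y → (∀ x → y ∈ᴸ x → P x) → Large P
    large-cone {P} y cone⊆P =
      large-map {P = λ x → y ∈ᴸ x} cone⊆P (large (⌊⌋-intro (inj₁ (lift (⌊⌋-intro (y , refl))))))

    large-∃ : ∀ {P : X → Set ℓ} → Large P → Σ[ x ∈ X ] P x
    large-∃ (large p) with 𝒰-good (_ ∷ []) (p ∷ [])
    ... | x , x∈ ∷ [] = x , ⌊⌋-elim x∈

    -- If all finite intersections from `𝒰` met `P`, maximality would make `P` large. So one of them
    -- avoids `P`, and the complement contains it.
    large-¬ : ∀ {P : X → Set ℓ} → ¬ Large P → Large (λ x → ¬ P x)
    large-¬ {P} ¬large = large (𝒰-closed (proj₁ outside) _ (proj₁ (proj₂ outside)) λ x x∈ →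
      ⌊⌋-intro λ p → proj₂ (proj₂ outside) (x , ⌊⌋-intro p , x∈))
      where
      S : 𝒫 X
      S x = ⌊ P x ⌋

      Intersecting : List (𝒫 X) → Set ℓ
      Intersecting zs = Σ[ x ∈ X ] x ∈ₚ S × All (x ∈ₚ_) zs

      intersecting : (∀ zs → All (_∈ₚ 𝒰) zs → Intersecting zs) → Large P
      intersecting meets = large (top-maximal cones-good S λ ws ws∈ →
        let ws′ , ws′∈ , imp = reduce S ws ws∈
            x , x∈S , x∈ = meets ws′ ws′∈
        in x , imp x x∈S x∈)

      outside : Σ[ zs ∈ List (𝒫 X) ] All (_∈ₚ 𝒰) zs × ¬ Intersecting zs
      outside = decidable-stable em λ none → ¬large (intersecting λ zs zs∈ →
        decidable-stable em λ disjoint → none (zs , zs∈ , disjoint))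

-- Ultraproducts

module Ultraproduct {ℓ : Level} (em : ExcludedMiddle ℓ) (ext : Extensionality ℓ 0ℓ)
                    (L : Language ℓ) (Y : Set ℓ) (M : List Y → Structure L ℓ) where

  open Classical em ext
  open Ultrafilter Y

  Product : Set ℓ
  Product = ∀ x → Carrier (M x)

  infix 4 _≈_
  _≈_ : Product → Product → Set
  f ≈ g = Large (λ x → f x ≡ g x)

  class : Product → 𝒫 Product
  class f g = ⌊ Lift ℓ (f ≈ g) ⌋

  choose : 𝒫 Product → Product
  choose S with em {Σ[ f ∈ Product ] f ∈ₚ S}
  ... | yes (f , _) = f
  ... | no _        = λ x → point (M x)

  choose-∈ : ∀ {S f} → f ∈ₚ S → choose S ∈ₚ S
  choose-∈ {S} {f} f∈S with em {Σ[ f ∈ Product ] f ∈ₚ S}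
  ... | yes (_ , g∈S) = g∈S
  ... | no empty      = contradiction (f , f∈S) empty

  -- Classes are functions into Bool, so equivalent elements have equal classes and the
  -- choice from the class is a canonical representative.
  rep : Product → Product
  rep f = choose (class f)

  ≈-rep : ∀ f → f ≈ rep f
  ≈-rep f = lower (⌊⌋-elim (choose-∈ {class f} {f} (⌊⌋-intro (lift (large-all λ _ → refl)))))

  rep-cong : ∀ {f g} → f ≈ g → rep f ≡ rep g
  rep-cong f≈g = cong choose (⊆ₚ-antisym
    (λ h h∈ → ⌊⌋-intro (lift (large-zip (λ _ p q → trans (sym p) q) f≈g (lower (⌊⌋-elim h∈)))))
    (λ h h∈ → ⌊⌋-intro (lift (large-zip (λ _ p q → trans p q) f≈g (lower (⌊⌋-elim h∈))))))

  Element : Set ℓ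
  Element = Σ[ f ∈ Product ] rep f ≡ f

  ⟦_⟧ : Product → Element
  ⟦ f ⟧ = rep f , rep-cong (large-map (λ _ → sym) (≈-rep f))

  infix 9 _at_
  _at_ : Element → ∀ x → Carrier (M x)
  e at x = proj₁ e x

  ats : ∀ {n} → Vec Element n → ∀ x → Vec (Carrier (M x)) n
  ats v x = map (_at x) v

  ⟦⟧-at : ∀ f → Large (λ x → ⟦ f ⟧ at x ≡ f x)
  ⟦⟧-at f = large-map (λ _ → sym) (≈-rep f)

  element-≡ : ∀ {e e′ : Element} → Large (λ x → e at x ≡ e′ at x) → e ≡ e′
  element-≡ {f , rf} {g , rg} f≈g with trans (sym rf) (trans (rep-cong f≈g) rg)
  ... | refl = cong (f ,_) (uip rf rg)

  ultraproduct : Structure L ℓ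
  ultraproduct = record
    { Carrier = Element
    ; point   = ⟦ (λ x → point (M x)) ⟧
    ; funcᴵ   = λ F v → ⟦ (λ x → funcᴵ (M x) F (ats v x)) ⟧
    ; relᴵ    = λ R v → Lift ℓ (Large (λ x → relᴵ (M x) R (ats v x)))
    }

  mutual
    eval-at : ∀ {n} (v : Vec Element n) (t : Term L n) →
              Large (λ x → eval ultraproduct v t at x ≡ eval (M x) (ats v x) t)
    eval-at v (var i)   = large-all λ x → sym (Vecₚ.lookup-map i (_at x) v)
    eval-at v (fn F ts) = large-zip (λ x p q → trans p (cong (funcᴵ (M x) F) q))
                            (⟦⟧-at _) (evals-at v ts)

    evals-at : ∀ {n k} (v : Vec Element n) (ts : Vec (Term L n) k) →
               Large (λ x → ats (evals ultraproduct v ts) x ≡ evals (M x) (ats v x) ts)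
    evals-at v []       = large-all λ _ → refl
    evals-at v (t ∷ ts) = large-zip (λ _ → cong₂ _∷_) (eval-at v t) (evals-at v ts)

  mutual
    -- Both directions are proved together because `⇒ᶠ` exchanges them in its premise. For `allᶠ`
    -- the element tested is a pointwise choice of counterexamples: if the formula holds of it, a
    -- large set of coordinates has none.
    łoś⁺ : ∀ {n} (φ : Formula L n) (v : Vec Element n) →
           ultraproduct ⊨ φ [ v ] → Large (λ x → M x ⊨ φ [ ats v x ])
    łoś⁺ ⊥ᶠ         v p        = Polymorphic.⊥-elim p
    łoś⁺ (s == t)   v p        = large-zip (λ x q r → trans (sym q) (trans (cong (_at x) p) r))
                                   (eval-at v s) (eval-at v t)
    łoś⁺ (rel R ts) v (lift p) = large-zip (λ x → subst (relᴵ (M x) R)) (evals-at v ts) p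
    łoś⁺ (φ ⇒ᶠ ψ)   v p with em {Lift ℓ (Large (λ x → M x ⊨ φ [ ats v x ]))}
    ... | yes (lift q) = large-map (λ _ r _ → r) (łoś⁺ ψ v (p (łoś⁻ φ v q)))
    ... | no ¬q        = large-map (λ _ ¬r r → contradiction r ¬r) (large-¬ (¬q ∘ lift))
    łoś⁺ (allᶠ φ)   v p = large-zip (λ x e q → counterexample-good x (subst (Good x) e q))
      (⟦⟧-at counterexample) (łoś⁺ φ (⟦ counterexample ⟧ ∷ v) (p ⟦ counterexample ⟧))
      where
      Good : ∀ x → Carrier (M x) → Set ℓ
      Good x y = M x ⊨ φ [ y ∷ ats v x ]

      counterexample : Product
      counterexample x with em {Σ[ y ∈ Carrier (M x) ] ¬ M x ⊨ φ [ y ∷ ats v x ]}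
      ... | yes (y , _) = y
      ... | no _        = point (M x)

      counterexample-good : ∀ x → M x ⊨ φ [ counterexample x ∷ ats v x ] → M x ⊨ allᶠ φ [ ats v x ]
      counterexample-good x good with em {Σ[ y ∈ Carrier (M x) ] ¬ M x ⊨ φ [ y ∷ ats v x ]}
      ... | yes (y , bad) = contradiction good bad
      ... | no none       = λ y → decidable-stable em λ bad → none (y , bad)

    łoś⁻ : ∀ {n} (φ : Formula L n) (v : Vec Element n) →
           Large (λ x → M x ⊨ φ [ ats v x ]) → ultraproduct ⊨ φ [ v ]
    łoś⁻ ⊥ᶠ         v p = proj₂ (large-∃ p)
    łoś⁻ (s == t)   v p = element-≡ (large-zip (λ _ q r → trans r (sym q)) (eval-at v t)
                            (large-zip (λ _ q r → trans q r) (eval-at v s) p))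
    łoś⁻ (rel R ts) v p = lift (large-zip (λ x e → subst (relᴵ (M x) R) (sym e)) (evals-at v ts) p)
    łoś⁻ (φ ⇒ᶠ ψ)   v p q = łoś⁻ ψ v (large-zip (λ _ r s → r s) p (łoś⁺ φ v q))
    łoś⁻ (allᶠ φ)   v p e = łoś⁻ φ (e ∷ v) (large-map (λ x q → q (e at x)) p)

  ultraproduct-⊨ᵀ : ∀ {T : Theory L} → (∀ x → M x ⊨ᵀ T) → ultraproduct ⊨ᵀ T
  ultraproduct-⊨ᵀ M⊨T σ σ∈T = łoś⁻ σ [] (large-all λ x → M⊨T x σ σ∈T)

  ⟦_⟧ᵛ : ∀ {k} → (∀ x → Vec (Carrier (M x)) k) → Vec Element k
  ⟦ v ⟧ᵛ = tabulate λ s → ⟦ (λ x → lookup (v x) s) ⟧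

  ats-⟦⟧ᵛ : ∀ {k} (v : ∀ x → Vec (Carrier (M x)) k) → Large (λ x → ats ⟦ v ⟧ᵛ x ≡ v x)
  ats-⟦⟧ᵛ v = large-map (λ x p → trans p (Vecₚ.tabulate∘lookup (v x)))
                        (pointwise (λ s x → lookup (v x) s))
    where
    pointwise : ∀ {k} (f : Fin k → Product) →
                Large (λ x → ats (tabulate (λ s → ⟦ f s ⟧)) x ≡ tabulate (λ s → f s x))
    pointwise {zero}  f = large-all λ _ → refl
    pointwise {suc k} f = large-zip (λ _ → cong₂ _∷_) (⟦⟧-at (f zero)) (pointwise (f ∘ suc))

  module _ {m′ l′} {L′ : Language l′} (I : Structure L′ m′) {k : ℕ}
           (a : ∀ x → Carrier I → Vec (Carrier (M x)) k) where

    ultrafamily : Carrier I → Vec Element k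
    ultrafamily i = ⟦ (λ x → a x i) ⟧ᵛ

    ats-tuple : ∀ {n} (is : Vec (Carrier I) n) →
                Large (λ x → ats (tuple I ultraproduct ultrafamily is) x ≡ tuple I (M x) (a x) is)
    ats-tuple []       = large-all λ _ → refl
    ats-tuple (i ∷ is) = large-zip
      (λ x p q → trans (Vecₚ.map-++ (_at x) (ultrafamily i) _) (cong₂ _++_ p q))
      (ats-⟦⟧ᵛ (λ x → a x i)) (ats-tuple is)

    tuple-⁺ : ∀ {n} (φ : Formula L _) (is : Vec (Carrier I) n) →
              ultraproduct ⊨ φ [ tuple I ultraproduct ultrafamily is ] →
              Large (λ x → M x ⊨ φ [ tuple I (M x) (a x) is ])
    tuple-⁺ φ is p = large-zip (λ x → subst (λ v → M x ⊨ φ [ v ])) (ats-tuple is) (łoś⁺ φ _ p)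

    tuple-⁻ : ∀ {n} (φ : Formula L _) (is : Vec (Carrier I) n) →
              Large (λ x → M x ⊨ φ [ tuple I (M x) (a x) is ]) →
              ultraproduct ⊨ φ [ tuple I ultraproduct ultrafamily is ]
    tuple-⁻ φ is p = łoś⁻ φ _ (large-zip (λ x e → subst (λ v → M x ⊨ φ [ v ]) (sym e)) (ats-tuple is) p)

-- Renaming, and quantifier-free types of ordered graphs

substituteBlocks : ∀ {n n′} k → (Fin n → Fin n′) → Fin (n * k) → Fin (n′ * k)
substituteBlocks {n} k σ x = let r , s = remQuot {n} k x in combine (σ r) s

module _ {l : Level} {L : Language l} where

  mutual
    renameᵗ : ∀ {m n} → (Fin n → Fin m) → Term L n → Term L m
    renameᵗ ρ (var i)   = var (ρ i)
    renameᵗ ρ (fn f ts) = fn f (renameᵗˢ ρ ts)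

    renameᵗˢ : ∀ {m n k} → (Fin n → Fin m) → Vec (Term L n) k → Vec (Term L m) k
    renameᵗˢ ρ []       = []
    renameᵗˢ ρ (t ∷ ts) = renameᵗ ρ t ∷ renameᵗˢ ρ ts

  rename : ∀ {m n} → (Fin n → Fin m) → Formula L n → Formula L m
  rename ρ ⊥ᶠ         = ⊥ᶠ
  rename ρ (s == t)   = renameᵗ ρ s == renameᵗ ρ t
  rename ρ (rel r ts) = rel r (renameᵗˢ ρ ts)
  rename ρ (φ ⇒ᶠ ψ)   = rename ρ φ ⇒ᶠ rename ρ ψ
  rename ρ (allᶠ φ)   = allᶠ (rename (Fin.lift 1 ρ) φ)

  module _ {m′ : Level} (M : Structure L m′) where

    mutual
      eval-rename : ∀ {m n} (ρ : Fin n → Fin m) {v w} → (∀ i → lookup w i ≡ lookup v (ρ i)) →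
                    ∀ t → eval M v (renameᵗ ρ t) ≡ eval M w t
      eval-rename ρ v≡w (var i)   = sym (v≡w i)
      eval-rename ρ v≡w (fn f ts) = cong (funcᴵ M f) (evals-rename ρ v≡w ts)

      evals-rename : ∀ {m n} (ρ : Fin n → Fin m) {v w} → (∀ i → lookup w i ≡ lookup v (ρ i)) →
                     ∀ {k} (ts : Vec (Term L n) k) → evals M v (renameᵗˢ ρ ts) ≡ evals M w ts
      evals-rename ρ v≡w []       = refl
      evals-rename ρ v≡w (t ∷ ts) = cong₂ _∷_ (eval-rename ρ v≡w t) (evals-rename ρ v≡w ts)

    ⊨-rename : ∀ {m n} (ρ : Fin n → Fin m) {v w} → (∀ i → lookup w i ≡ lookup v (ρ i)) →
               ∀ φ → (M ⊨ rename ρ φ [ v ]) ⇔ (M ⊨ φ [ w ])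
    ⊨-rename ρ v≡w ⊥ᶠ         = mk⇔ (λ p → p) (λ p → p)
    ⊨-rename ρ v≡w (s == t)   = mk⇔
      (λ p → trans (sym (eval-rename ρ v≡w s)) (trans p (eval-rename ρ v≡w t)))
      (λ p → trans (eval-rename ρ v≡w s) (trans p (sym (eval-rename ρ v≡w t))))
    ⊨-rename ρ v≡w (rel r ts) = mk⇔
      (subst (relᴵ M r) (evals-rename ρ v≡w ts)) (subst (relᴵ M r) (sym (evals-rename ρ v≡w ts)))
    ⊨-rename ρ v≡w (φ ⇒ᶠ ψ)   = mk⇔
      (λ p q → to (⊨-rename ρ v≡w ψ) (p (from (⊨-rename ρ v≡w φ) q)))
      (λ p q → from (⊨-rename ρ v≡w ψ) (p (to (⊨-rename ρ v≡w φ) q)))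
    ⊨-rename {m} {n} ρ {v} {w} v≡w (allᶠ φ) = mk⇔
      (λ p x → to (⊨-rename (Fin.lift 1 ρ) (extended x) φ) (p x))
      (λ p x → from (⊨-rename (Fin.lift 1 ρ) (extended x) φ) (p x))
      where
      extended : ∀ x i → lookup (x ∷ w) i ≡ lookup (x ∷ v) (Fin.lift 1 ρ i)
      extended x zero    = refl
      extended x (suc i) = v≡w i

  module _ {l′ m m′ : Level} {L′ : Language l′} (I : Structure L′ m′) (M : Structure L m)
           {k : ℕ} (a : Carrier I → Vec (Carrier M) k) where

    lookup-tuple : ∀ {n} (is : Vec (Carrier I) n) r s →
                   lookup (tuple I M a is) (combine r s) ≡ lookup (a (lookup is r)) s
    lookup-tuple is r s = trans (Vecₚ.lookup-concat (map a is) r s)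
                                (cong (λ v → lookup v s) (Vecₚ.lookup-map r a is))

    ⊨-rename-tuple : ∀ {n N} (ρ : Fin (n * k) → Fin N) (v : Vec (Carrier M) N) (is : Vec (Carrier I) n) →
      (∀ r s → lookup v (ρ (combine r s)) ≡ lookup (a (lookup is r)) s) →
      ∀ φ → (M ⊨ rename ρ φ [ v ]) ⇔ (M ⊨ φ [ tuple I M a is ])
    ⊨-rename-tuple {n} ρ v is blocks = ⊨-rename M ρ λ x →
      subst (λ x → lookup (tuple I M a is) x ≡ lookup v (ρ x)) (Finₚ.combine-remQuot {n} k x)
            (let r , s = remQuot {n} k x in trans (lookup-tuple is r s) (sym (blocks r s)))

  ⊨-substituteBlocks : ∀ {l′ m m′} {L′ : Language l′} (I : Structure L′ m′) (M : Structure L m)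
    {k} (a : Carrier I → Vec (Carrier M) k) {n n′} (σ : Fin n → Fin n′)
    (is : Vec (Carrier I) n) (js : Vec (Carrier I) n′) → (∀ r → lookup js (σ r) ≡ lookup is r) →
    ∀ φ → (M ⊨ rename (substituteBlocks k σ) φ [ tuple I M a js ]) ⇔ (M ⊨ φ [ tuple I M a is ])
  ⊨-substituteBlocks I M {k} a {n} σ is js eq =
    ⊨-rename-tuple I M a (substituteBlocks k σ) (tuple I M a js) is λ r s →
      trans (cong (λ rs → lookup (tuple I M a js) (combine (σ (proj₁ rs)) (proj₂ rs)))
                  (Finₚ.remQuot-combine {n} {k} r s))
     (trans (lookup-tuple I M a js (σ r) s) (cong (λ i → lookup (a i) s) (eq r)))

-- Atoms and sorting of tuples in ordered graphs

module _ {m : Level} (I : Structure Lg m) where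

  Lt Adj : Carrier I → Carrier I → Set m
  Lt x y  = relᴵ I lt (x ∷ y ∷ [])
  Adj x y = relᴵ I edge (x ∷ y ∷ [])

record SameAtoms {m m′ : Level} (I : Structure Lg m) (J : Structure Lg m′) {n : ℕ}
                 (i : Fin n → Carrier I) (j : Fin n → Carrier J) : Set (m Level.⊔ m′) where
  field
    equal    : ∀ r s → i r ≡ i s ⇔ j r ≡ j s
    ordered  : ∀ r s → Lt I (i r) (i s) ⇔ Lt J (j r) (j s)
    adjacent : ∀ r s → Adj I (i r) (i s) ⇔ Adj J (j r) (j s)

sameAtoms-qf : ∀ {m m′} {I : Structure Lg m} {J : Structure Lg m′} {n} {i : Vec (Carrier I) n}
  {j : Vec (Carrier J) n} → SameAtoms I J (lookup i) (lookup j) →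
  ∀ {φ} → QuantifierFree φ → (I ⊨ φ [ i ]) ⇔ (J ⊨ φ [ j ])
sameAtoms-qf same ⊥ᶠ = mk⇔ (λ ()) (λ ())
sameAtoms-qf same (var r == var s) = SameAtoms.equal same r s
sameAtoms-qf same (fn () _ == _)
sameAtoms-qf same (var _ == fn () _)
sameAtoms-qf same (rel lt (var r ∷ var s ∷ [])) = SameAtoms.ordered same r s
sameAtoms-qf same (rel edge (var r ∷ var s ∷ [])) = SameAtoms.adjacent same r s
sameAtoms-qf same (rel _ (fn () _ ∷ _))
sameAtoms-qf same (rel _ (var _ ∷ fn () _ ∷ _))
sameAtoms-qf same (p ⇒ᶠ q) = mk⇔
  (λ f x → to (sameAtoms-qf same q) (f (from (sameAtoms-qf same p) x)))
  (λ f x → from (sameAtoms-qf same q) (f (to (sameAtoms-qf same p) x)))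

sameAtoms⇒qftp : ∀ {m} {I : Structure Lg m} {n} {i j : Vec (Carrier I) n} →
                 SameAtoms I I (lookup i) (lookup j) → qftp I i ≐ qftp I j
sameAtoms⇒qftp same = (λ (qf , p) → qf , to (sameAtoms-qf same qf) p)
                    , (λ (qf , p) → qf , from (sameAtoms-qf same qf) p)

qftp⇒sameAtoms : ∀ {m} {I : Structure Lg m} {n} {i j : Vec (Carrier I) n} →
                 qftp I i ≐ qftp I j → SameAtoms I I (lookup i) (lookup j)
qftp⇒sameAtoms {I = I} {i = i} {j} (⊆ , ⊇) = record
  { equal    = λ r s → atom (var r == var s)
  ; ordered  = λ r s → atom (rel lt (var r ∷ var s ∷ []))
  ; adjacent = λ r s → atom (rel edge (var r ∷ var s ∷ []))
  }
  where
  atom : ∀ {φ} → QuantifierFree φ → (I ⊨ φ [ i ]) ⇔ (I ⊨ φ [ j ])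
  atom qf = mk⇔ (λ p → proj₂ (⊆ (qf , p))) (λ p → proj₂ (⊇ (qf , p)))

Monotone : ∀ {m} (I : Structure Lg m) {n} → (Fin n → Carrier I) → Set m
Monotone I u = ∀ x y → x Fin.< y → Lt I (u x) (u y)

module TgModel {m : Level} (em : ExcludedMiddle m) {I : Structure Lg m} (I⊨Tg : I ⊨ᵀ Tg) where

  Lt-irrefl : ∀ {x} → ¬ Lt I x x
  Lt-irrefl {x} x<x = lower (I⊨Tg _ <-irreflexive x x<x)

  Lt-trans : ∀ {x y z} → Lt I x y → Lt I y z → Lt I x z
  Lt-trans {x} {y} {z} = I⊨Tg _ <-transitive z y x

  Lt-cmp : ∀ x y → Lt I x y ⊎ x ≡ y ⊎ Lt I y x
  Lt-cmp x y with em {Lt I x y} | em {x ≡ y}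
  ... | yes x<y | _       = inj₁ x<y
  ... | no _    | yes x≡y = inj₂ (inj₁ x≡y)
  ... | no x≮y  | no x≢y  = inj₂ (inj₂ (I⊨Tg _ <-total y x
    (λ p → contradiction p x≮y) (λ p → contradiction p x≢y)))

  Adj-sym : ∀ {x y} → Adj I x y → Adj I y x
  Adj-sym {x} {y} = I⊨Tg _ R-symmetric y x

  Adj-irrefl : ∀ {x} → ¬ Adj I x x
  Adj-irrefl {x} xRx = lower (I⊨Tg _ R-irreflexive x xRx)

  Sorted : List (Carrier I) → Set m
  Sorted = AllPairs (Lt I)

  insert : ∀ x ys → Sorted ys → Σ[ zs ∈ List (Carrier I) ] Sorted zs ×
           x ∈ᴸ zs × (∀ {y} → y ∈ᴸ ys → y ∈ᴸ zs) × (∀ {z} → z ∈ᴸ zs → z ≡ x ⊎ z ∈ᴸ ys)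
  insert x []       []             = x ∷ [] , [] ∷ [] , hereᴸ refl , (λ ()) , λ { (hereᴸ eq) → inj₁ eq }
  insert x (y ∷ ys) (y<ys ∷ ys-sorted) with Lt-cmp x y
  ... | inj₁ x<y = x ∷ y ∷ ys , (x<y ∷ All.map (Lt-trans x<y) y<ys) ∷ y<ys ∷ ys-sorted , hereᴸ refl , thereᴸ
                 , λ { (hereᴸ eq) → inj₁ eq ; (thereᴸ z∈) → inj₂ z∈ }
  ... | inj₂ (inj₁ refl) = y ∷ ys , y<ys ∷ ys-sorted , hereᴸ refl , (λ y∈ → y∈) , inj₂
  ... | inj₂ (inj₂ y<x) with insert x ys ys-sorted
  ...   | zs , zs-sorted , x∈ , ⊆zs , zs⊆ =
    y ∷ zs
    , All.tabulate (λ z∈ → [ (λ { refl → y<x }) , All.lookup y<ys ]′ (zs⊆ z∈)) ∷ zs-sorted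
    , thereᴸ x∈
    , (λ { (hereᴸ eq) → hereᴸ eq ; (thereᴸ z∈) → thereᴸ (⊆zs z∈) })
    , λ { (hereᴸ eq) → inj₂ (hereᴸ eq)
        ; (thereᴸ z∈) → [ inj₁ , (λ z∈ys → inj₂ (thereᴸ z∈ys)) ]′ (zs⊆ z∈) }

  sort : ∀ {n} (c : Fin n → Carrier I) → Σ[ ys ∈ List (Carrier I) ] Sorted ys ×
         (∀ r → c r ∈ᴸ ys) × (∀ {y} → y ∈ᴸ ys → ∃[ r ] c r ≡ y)
  sort {zero}  c = [] , [] , (λ ()) , λ ()
  sort {suc n} c with sort (c ∘ suc)
  ... | ys , ys-sorted , ⊆ys , ys⊆ with insert (c zero) ys ys-sorted
  ... | zs , zs-sorted , c₀∈ , ⊆zs , zs⊆ =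
    zs , zs-sorted
    , (λ { zero → c₀∈ ; (suc r) → ⊆zs (⊆ys r) })
    , λ z∈ → [ (λ eq → zero , sym eq) , (λ z∈ys → let r , eq = ys⊆ z∈ys in suc r , eq) ]′ (zs⊆ z∈)

  sorted-lookup : ∀ {ys} → Sorted ys → Monotone I (List.lookup ys)
  sorted-lookup (y<ys ∷ _)   zero    (suc y) _         = All.lookup y<ys (∈-lookup y)
  sorted-lookup (_ ∷ sorted) (suc x) (suc y) (s≤s x<y) = sorted-lookup sorted x y x<y

  -- Reduces an unsorted tuple with repetitions to an increasing one: `c ∘ τ` lists the values in
  -- order, and `σ` locates each entry of `c` in the list.
  record Sorting {n : ℕ} (c : Fin n → Carrier I) : Set m where
    field
      number   : ℕ
      σ        : Fin n → Fin number
      τ        : Fin number → Fin n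
      monotone : Monotone I (c ∘ τ)
      factor   : ∀ r → c (τ (σ r)) ≡ c r

  sorting : ∀ {n} (c : Fin n → Carrier I) → Sorting c
  sorting c with sort c
  ... | ys , sorted , ⊆ys , ys⊆ = record
    { number   = length ys
    ; σ        = λ r → Any.index (⊆ys r)
    ; τ        = λ x → proj₁ (ys⊆ (∈-lookup x))
    ; monotone = λ x y x<y → subst₂ (Lt I) (sym (proj₂ (ys⊆ (∈-lookup x)))) (sym (proj₂ (ys⊆ (∈-lookup y))))
                               (sorted-lookup sorted x y x<y)
    ; factor   = λ r → trans (proj₂ (ys⊆ (∈-lookup (Any.index (⊆ys r))))) (sym (lookup-index (⊆ys r)))
    }

sameAtoms-monotone : ∀ {m m′} (em : ExcludedMiddle m) (em′ : ExcludedMiddle m′)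
  {I : Structure Lg m} {J : Structure Lg m′} → I ⊨ᵀ Tg → J ⊨ᵀ Tg →
  ∀ {n} {u : Fin n → Carrier I} {e : Fin n → Carrier J} → Monotone I u → Monotone J e →
  (∀ x y → x Fin.< y → Adj I (u x) (u y) ⇔ Adj J (e x) (e y)) → SameAtoms I J u e
sameAtoms-monotone em em′ {I} {J} I⊨Tg J⊨Tg {n} {u} {e} u-mono e-mono adj = record
  { equal    = equal
  ; ordered  = ordered
  ; adjacent = adjacent
  }
  where
  module I = TgModel em I⊨Tg
  module J = TgModel em′ J⊨Tg

  equal : ∀ x y → u x ≡ u y ⇔ e x ≡ e y
  equal x y with Finₚ.<-cmp x y
  ... | tri< x<y _ _ = mk⇔ (λ eq → contradiction (subst (Lt I (u x)) (sym eq) (u-mono x y x<y)) I.Lt-irrefl)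
                           (λ eq → contradiction (subst (Lt J (e x)) (sym eq) (e-mono x y x<y)) J.Lt-irrefl)
  ... | tri≈ _ refl _ = mk⇔ (λ _ → refl) (λ _ → refl)
  ... | tri> _ _ y<x = mk⇔ (λ eq → contradiction (subst (Lt I (u y)) eq (u-mono y x y<x)) I.Lt-irrefl)
                           (λ eq → contradiction (subst (Lt J (e y)) eq (e-mono y x y<x)) J.Lt-irrefl)

  ordered : ∀ x y → Lt I (u x) (u y) ⇔ Lt J (e x) (e y)
  ordered x y with Finₚ.<-cmp x y
  ... | tri< x<y _ _ = mk⇔ (λ _ → e-mono x y x<y) (λ _ → u-mono x y x<y)
  ... | tri≈ _ refl _ = mk⇔ (λ p → contradiction p I.Lt-irrefl) (λ p → contradiction p J.Lt-irrefl)
  ... | tri> _ _ y<x = mk⇔ (λ p → contradiction (I.Lt-trans p (u-mono y x y<x)) I.Lt-irrefl)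
                           (λ p → contradiction (J.Lt-trans p (e-mono y x y<x)) J.Lt-irrefl)

  adjacent : ∀ x y → Adj I (u x) (u y) ⇔ Adj J (e x) (e y)
  adjacent x y with Finₚ.<-cmp x y
  ... | tri< x<y _ _ = adj x y x<y
  ... | tri≈ _ refl _ = mk⇔ (λ p → contradiction p I.Adj-irrefl) (λ p → contradiction p J.Adj-irrefl)
  ... | tri> _ _ y<x = mk⇔ (λ p → J.Adj-sym (to (adj y x y<x) (I.Adj-sym p)))
                           (λ p → I.Adj-sym (from (adj y x y<x) (J.Adj-sym p)))

sameAtoms-∘ : ∀ {m m′} {I : Structure Lg m} {J : Structure Lg m′} {n n′} {u : Fin n′ → Carrier I}
  {e : Fin n′ → Carrier J} {i : Fin n → Carrier I} {j : Fin n → Carrier J} (σ : Fin n → Fin n′) →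
  (∀ r → u (σ r) ≡ i r) → (∀ r → e (σ r) ≡ j r) → SameAtoms I J u e → SameAtoms I J i j
sameAtoms-∘ {I = I} {J} σ u∘σ e∘σ same = record
  { equal    = λ r s → subst₂ _⇔_ (cong₂ _≡_ (u∘σ r) (u∘σ s)) (cong₂ _≡_ (e∘σ r) (e∘σ s))
      (equal (σ r) (σ s))
  ; ordered  = λ r s → subst₂ _⇔_ (cong₂ (Lt I) (u∘σ r) (u∘σ s)) (cong₂ (Lt J) (e∘σ r) (e∘σ s))
      (ordered (σ r) (σ s))
  ; adjacent = λ r s → subst₂ _⇔_ (cong₂ (Adj I) (u∘σ r) (u∘σ s)) (cong₂ (Adj J) (e∘σ r) (e∘σ s))
      (adjacent (σ r) (σ s))
  }
  where open SameAtoms same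

-- The Rado graph

twice : ℕ → ℕ
twice zero    = zero
twice (suc n) = suc (suc (twice n))

odd? : ℕ → Bool
odd? zero          = false
odd? (suc zero)    = true
odd? (suc (suc n)) = odd? n

odd?-twice : ∀ n → odd? (twice n) ≡ false
odd?-twice zero    = refl
odd?-twice (suc n) = odd?-twice n

odd?-suc-twice : ∀ n → odd? (suc (twice n)) ≡ true
odd?-suc-twice zero    = refl
odd?-suc-twice (suc n) = odd?-suc-twice n

half-twice : ∀ n → ⌊ twice n /2⌋ ≡ n
half-twice zero    = refl
half-twice (suc n) = cong suc (half-twice n)

half-suc-twice : ∀ n → ⌊ suc (twice n) /2⌋ ≡ n
half-suc-twice zero    = refl
half-suc-twice (suc n) = cong suc (half-suc-twice n)

binaryDigit : ℕ → ℕ → Bool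
binaryDigit zero    n = odd? n
binaryDigit (suc i) n = binaryDigit i ⌊ n /2⌋

-- The digits of a number with prescribed digits at the first N places; the digit at place
-- N is 1, so that the number exceeds N.
fromDigits : (ℕ → Bool) → ℕ → ℕ
fromDigits g zero    = 1
fromDigits g (suc N) = (if g 0 then suc else id) (twice (fromDigits (g ∘ suc) N))

binaryDigit-fromDigits : ∀ g N i → i ℕ.< N → binaryDigit i (fromDigits g N) ≡ g i
binaryDigit-fromDigits g (suc N) zero    i<N with g 0
... | true  = odd?-suc-twice (fromDigits (g ∘ suc) N)
... | false = odd?-twice (fromDigits (g ∘ suc) N)
binaryDigit-fromDigits g (suc N) (suc i) (s≤s i<N) with g 0
... | true  = trans (cong (binaryDigit i) (half-suc-twice (fromDigits (g ∘ suc) N)))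
                    (binaryDigit-fromDigits (g ∘ suc) N i i<N)
... | false = trans (cong (binaryDigit i) (half-twice (fromDigits (g ∘ suc) N)))
                    (binaryDigit-fromDigits (g ∘ suc) N i i<N)

n≤twice : ∀ n → n ℕ.≤ twice n
n≤twice zero    = z≤n
n≤twice (suc n) = s≤s (ℕₚ.m≤n⇒m≤1+n (n≤twice n))

<-fromDigits : ∀ g N → N ℕ.< fromDigits g N
<-fromDigits g zero    = s≤s z≤n
<-fromDigits g (suc N) with fromDigits (g ∘ suc) N | <-fromDigits (g ∘ suc) N | g 0
... | suc c | s≤s N≤c | true  = s≤s (s≤s (ℕₚ.m≤n⇒m≤1+n (ℕₚ.≤-trans N≤c (n≤twice c))))
... | suc c | s≤s N≤c | false = s≤s (s≤s (ℕₚ.≤-trans N≤c (n≤twice c)))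

-- Ackermann's binary presentation of the random graph: choosing digits of a larger number chooses
-- its adjacencies to smaller ones.
rado : ℕ → ℕ → Bool
rado x y = ((x <ᵇ y) ∧ binaryDigit x y) ∨ ((y <ᵇ x) ∧ binaryDigit y x)

rado-sym : ∀ x y → rado x y ≡ rado y x
rado-sym x y = Boolₚ.∨-comm ((x <ᵇ y) ∧ binaryDigit x y) _

<ᵇ-irrefl : ∀ x → (x <ᵇ x) ≡ false
<ᵇ-irrefl zero    = refl
<ᵇ-irrefl (suc x) = <ᵇ-irrefl x

<⇒<ᵇ-true : ∀ {x y} → x ℕ.< y → (x <ᵇ y) ≡ true
<⇒<ᵇ-true {zero}  {suc y} _         = refl
<⇒<ᵇ-true {suc x} {suc y} (s≤s x<y) = <⇒<ᵇ-true x<y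

<⇒>ᵇ-false : ∀ {x y} → x ℕ.< y → (y <ᵇ x) ≡ false
<⇒>ᵇ-false {zero}  {suc y} _         = refl
<⇒>ᵇ-false {suc x} {suc y} (s≤s x<y) = <⇒>ᵇ-false x<y

rado-irrefl : ∀ x → rado x x ≡ false
rado-irrefl x rewrite <ᵇ-irrefl x = refl

rado-< : ∀ {x y} → x ℕ.< y → rado x y ≡ binaryDigit x y
rado-< {x} {y} x<y rewrite <⇒<ᵇ-true x<y | <⇒>ᵇ-false x<y = Boolₚ.∨-identityʳ _

-- Vertices are placed in increasing order. The prescribed digits below `B` carry the obligations:
-- once `e₀` is placed, adjacency to it is digit `e₀` of each later vertex.
rado-universal : ∀ {n} B (pre : Fin n → ℕ → Bool) (g : Fin n → Fin n → Bool) →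
  Σ[ e ∈ (Fin n → ℕ) ]
    (∀ y → B ℕ.≤ e y) × (∀ y t → t ℕ.< B → binaryDigit t (e y) ≡ pre y t) ×
    (∀ x y → x Fin.< y → e x ℕ.< e y × binaryDigit (e x) (e y) ≡ g x y)
rado-universal {zero}  B pre g = (λ ()) , (λ ()) , (λ ()) , λ ()
rado-universal {suc n} B pre g with rado-universal (suc e₀) pre′ (λ x y → g (suc x) (suc y))
  where
  e₀ = fromDigits (pre zero) B
  pre′ : Fin n → ℕ → Bool
  -- From `B` on only the place `e₀` carries an obligation; the places between get the same digit.
  pre′ y t = if t <ᵇ B then pre (suc y) t else g zero (suc y)
... | e , above , digits , graph = e′ , above′ , digits′ , graph′
  where
  e₀ = fromDigits (pre zero) B

  B<e₀ : B ℕ.< e₀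
  B<e₀ = <-fromDigits (pre zero) B

  e′ : Fin (suc n) → ℕ
  e′ zero    = e₀
  e′ (suc y) = e y

  above′ : ∀ y → B ℕ.≤ e′ y
  above′ zero    = ℕₚ.<⇒≤ B<e₀
  above′ (suc y) = ℕₚ.≤-trans (ℕₚ.<⇒≤ (ℕₚ.m≤n⇒m≤1+n B<e₀)) (above y)

  digits′ : ∀ y t → t ℕ.< B → binaryDigit t (e′ y) ≡ pre y t
  digits′ zero    t t<B = binaryDigit-fromDigits (pre zero) B t t<B
  digits′ (suc y) t t<B = trans (digits y t (ℕₚ.m≤n⇒m≤1+n (ℕₚ.<-trans t<B B<e₀)))
    (cong (if_then pre (suc y) t else g zero (suc y)) (<⇒<ᵇ-true t<B))

  graph′ : ∀ x y → x Fin.< y → e′ x ℕ.< e′ y × binaryDigit (e′ x) (e′ y) ≡ g x y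
  graph′ zero    (suc y) _         = above y , trans (digits y e₀ (ℕₚ.n<1+n e₀))
    (cong (if_then pre (suc y) e₀ else g zero (suc y)) (<⇒>ᵇ-false B<e₀))
  graph′ (suc x) (suc y) (s≤s x<y) = graph x y x<y

radoGraph : ∀ ℓ → Structure Lg ℓ
radoGraph ℓ = record { Carrier = Lift ℓ ℕ ; point = lift 0 ; funcᴵ = λ () ; relᴵ = relation }
  where
  relation : ∀ {k} → GraphRel k → Vec (Lift ℓ ℕ) k → Set ℓ
  relation lt   (lift x ∷ lift y ∷ []) = Lift ℓ (x ℕ.< y)
  relation edge (lift x ∷ lift y ∷ []) = Lift ℓ (rado x y ≡ true)

radoGraph-⊨Tg : ∀ ℓ → radoGraph ℓ ⊨ᵀ Tg
radoGraph-⊨Tg ℓ _ <-irreflexive (lift x) (lift x<x) = lift (ℕₚ.<-irrefl refl x<x)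
radoGraph-⊨Tg ℓ _ <-transitive (lift z) (lift y) (lift x) (lift x<y) (lift y<z) = lift (ℕₚ.<-trans x<y y<z)
radoGraph-⊨Tg ℓ _ <-total (lift y) (lift x) x≮y x≢y with ℕₚ.<-cmp x y
... | tri< x<y _ _  = ⊥-elim (lower (x≮y (lift x<y)))
... | tri≈ _ refl _ = ⊥-elim (lower (x≢y refl))
... | tri> _ _ y<x  = lift y<x
radoGraph-⊨Tg ℓ _ R-symmetric (lift y) (lift x) (lift xRy) = lift (trans (rado-sym y x) xRy)
radoGraph-⊨Tg ℓ _ R-irreflexive (lift x) (lift xRx) =
  lift (case trans (sym (rado-irrefl x)) xRx of λ ())

rado-embedding : ∀ ℓ {n} (g : Fin n → Fin n → Bool) →
  Σ[ e ∈ (Fin n → Carrier (radoGraph ℓ)) ] Monotone (radoGraph ℓ) e ×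
    (∀ x y → x Fin.< y → Adj (radoGraph ℓ) (e x) (e y) ⇔ g x y ≡ true)
rado-embedding ℓ g with rado-universal 0 (λ _ _ → false) g
... | e , _ , _ , graph = lift ∘ e , (λ x y x<y → lift (proj₁ (graph x y x<y))) , λ x y x<y →
  let eq = trans (rado-< (proj₁ (graph x y x<y))) (proj₂ (graph x y x<y))
  in mk⇔ (λ (lift xRy) → trans (sym eq) xRy) (λ gxy → lift (trans eq gxy))

-- Finite ordered graphs in saturated models

EmbedsOrderedGraphs : ∀ {m} → Structure Lg m → Set m
EmbedsOrderedGraphs I = ∀ {n} (g : Fin n → Fin n → Bool) →
  Σ[ e ∈ Vec (Carrier I) n ] Monotone I (lookup e) ×
    (∀ x y → x Fin.< y → Adj I (lookup e x) (lookup e y) ⇔ g x y ≡ true)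

-- The type realised is that of a copy of the graph in the Rado graph, which also witnesses its
-- consistency. Nonadjacency is carried over by negated atoms.
saturated-embedding : ∀ {ℓ} → ExcludedMiddle ℓ → {I : Structure Lg ℓ} → IsQFWeaklySaturatedModel Tg I →
  EmbedsOrderedGraphs I
saturated-embedding {ℓ} em {I} (_ , saturated) {n} g with rado-embedding ℓ g
... | u , u-mono , u-adj = e , e-mono , e-adj
  where
  R = radoGraph ℓ
  c = tabulate u

  realization : Σ[ e ∈ Vec (Carrier I) n ] Realizes I e (qftp R c)
  realization = saturated n (qftp R c)
    (proj₁ , λ φ qf → case em {R ⊨ φ [ c ]} of λ
      { (yes p) → inj₁ (qf , p) ; (no ¬p) → inj₂ ((qf ⇒ᶠ ⊥ᶠ) , λ p → contradiction p ¬p) })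
    (R , radoGraph-⊨Tg ℓ , c , λ φ (_ , p) → p)

  e = proj₁ realization

  e-mono : Monotone I (lookup e)
  e-mono x y x<y = proj₂ realization (x <ᶠ y) (rel lt _ , subst₂ (Lt R)
    (sym (Vecₚ.lookup∘tabulate u x)) (sym (Vecₚ.lookup∘tabulate u y)) (u-mono x y x<y))

  e-adj : ∀ x y → x Fin.< y → Adj I (lookup e x) (lookup e y) ⇔ g x y ≡ true
  e-adj x y x<y with g x y | u-adj x y x<y
  ... | true  | adj = mk⇔ (λ _ → refl) λ _ → proj₂ realization (x Rᶠ y) (rel edge _ , subst₂ (Adj R)
    (sym (Vecₚ.lookup∘tabulate u x)) (sym (Vecₚ.lookup∘tabulate u y)) (from adj refl))
  ... | false | adj = mk⇔
    (λ p → case lower (proj₂ realization (¬ᶠ (x Rᶠ y)) ((rel edge _ ⇒ᶠ ⊥ᶠ) , nonadjacent) p) of λ ())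
    (λ ())
    where
    nonadjacent : Adj R (lookup c x) (lookup c y) → Polymorphic.⊥
    nonadjacent p = case to adj
      (subst₂ (Adj R) (Vecₚ.lookup∘tabulate u x) (Vecₚ.lookup∘tabulate u y) p) of λ ()

radoGraph-saturated : ∀ {ℓ} → ExcludedMiddle ℓ → IsQFWeaklySaturatedModel Tg (radoGraph ℓ)
radoGraph-saturated {ℓ} em = radoGraph-⊨Tg ℓ , λ n p (p⊆QF , _) (N , N⊨Tg , c , c⊨p) →
  let open TgModel.Sorting (TgModel.sorting em N⊨Tg (lookup c))
      g = λ x y → ⌊ Adj N (lookup c (τ x)) (lookup c (τ y)) ⌋
      e , e-mono , e-adj = rado-embedding ℓ g
      i = tabulate (e ∘ σ)
      same = sameAtoms-∘ σ factor (λ r → sym (Vecₚ.lookup∘tabulate (e ∘ σ) r))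
        (sameAtoms-monotone em em N⊨Tg (radoGraph-⊨Tg ℓ) monotone e-mono λ x y x<y →
          mk⇔ (λ p → from (e-adj x y x<y) (⌊⌋-intro p)) (λ q → ⌊⌋-elim (to (e-adj x y x<y) q)))
  in i , λ φ φ∈p → to (sameAtoms-qf same (p⊆QF φ∈p)) (c⊨p φ φ∈p)
  where open Decide em

-- NIP implies collapse to indiscernible sequences

flip-invariant : ∀ {ℓ m} (P : Vec Bool m → Set ℓ) →
  (∀ G e → P (G [ e ]≔ true) ⇔ P (G [ e ]≔ false)) → ∀ G H → P G → P H
flip-invariant P flip []      []      p = p
flip-invariant P flip (b ∷ G) (c ∷ H) p =
  flip-invariant (λ G → P (c ∷ G)) (λ G e → flip (c ∷ G) (suc e)) G H (change b c p)
  where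
  change : ∀ b c → P (b ∷ G) → P (c ∷ G)
  change true  true  p = p
  change true  false p = to (flip (false ∷ G) zero) p
  change false true  p = from (flip (false ∷ G) zero) p
  change false false p = p

unbit : Fin 2 → Bool
unbit zero    = false
unbit (suc _) = true

unbit-bit : ∀ b → unbit (bit b) ≡ b
unbit-bit false = refl
unbit-bit true  = refl

lookup-++-if : ∀ {ℓ} {A : Set ℓ} {m n} (v : Vec A m) (w : Vec A n) b {x y} →
  lookup (v ++ w) (if b then m ↑ʳ y else x ↑ˡ n) ≡ (if b then lookup w y else lookup v x)
lookup-++-if v w true  {y = y} = Vecₚ.lookup-++ʳ v w y
lookup-++-if v w false {x = x} = Vecₚ.lookup-++ˡ v w x

module Forward {ℓ : Level} (em : ExcludedMiddle ℓ) (L : Language ℓ) (T : Theory L) (nip : HasNIP T)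
               (M : Structure L ℓ) (M⊨T : M ⊨ᵀ T) (I : Structure Lg ℓ) (I⊨Tg : I ⊨ᵀ Tg)
               (embeds : EmbedsOrderedGraphs I)
               (k : ℕ) (a : Carrier I → Vec (Carrier M) k) (ind : IsGeneralizedIndiscernible I M a) where

  open Decide em
  open TgModel em I⊨Tg

  -- Graphs are full matrices, so that any single entry can be flipped; only the entries above the
  -- diagonal matter.
  Copy : ∀ {n} → Vec (Carrier I) n → Vec Bool (n * n) → Set ℓ
  Copy i G = Monotone I (lookup i) ×
    (∀ x y → x Fin.< y → Adj I (lookup i x) (lookup i y) ⇔ lookup G (combine x y) ≡ true)

  copies-tp : ∀ {n} (G : Vec Bool (n * n)) (i j : Vec (Carrier I) n) → Copy i G → Copy j G →
              tp M (tuple I M a i) ≐ tp M (tuple I M a j)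
  copies-tp {n} G i j (i-mono , i-adj) (j-mono , j-adj) = proj₂ ind n i j (sameAtoms⇒qftp
    (sameAtoms-monotone em em I⊨Tg I⊨Tg i-mono j-mono λ x y x<y → mk⇔
      (λ p → from (j-adj x y x<y) (to (i-adj x y x<y) p))
      (λ p → from (i-adj x y x<y) (to (j-adj x y x<y) p))))

  -- Makes the truth of `ψ` a property of the graph alone, since by indiscernibility all increasing
  -- copies agree.
  True : ∀ n → Formula L (n * k) → Vec Bool (n * n) → Set ℓ
  True n ψ G = ∀ (i : Vec (Carrier I) n) → Copy i G → M ⊨ ψ [ tuple I M a i ]

  true⇔ : ∀ n (ψ : Formula L (n * k)) (G : Vec Bool (n * n)) (i : Vec (Carrier I) n) →
          Copy i G → True n ψ G ⇔ (M ⊨ ψ [ tuple I M a i ])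
  true⇔ n ψ G i copy = mk⇔ (λ t → t i copy) (λ p j copy′ → proj₁ (copies-tp G i j copy copy′) {ψ} p)

  -- The columns of an n-vertex graph are multiplied and the edge (s , t) is replaced by an
  -- arbitrary bipartite graph between the copies of s and of t; all other pairs are as in G.
  module _ (n : ℕ) (ψ : Formula L (n * k)) (G : Vec Bool (n * n)) (s t : Fin n) (s<t : s Fin.< t)
           (pol : Bool → Bool) (flipped : ∀ b → True n ψ (G [ combine s t ]≔ pol b) ⇔ b ≡ true) where

    mixAt : Fin n → Fin (n * k) → Fin (n * k + n * k)
    mixAt r x = if does (r Finₚ.≟ t) then n * k ↑ʳ x else x ↑ˡ n * k

    merge : {A : Set} → (Fin n → A) → (Fin n → A) → Fin n → A
    merge f g r = if does (r Finₚ.≟ t) then g r else f r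

    merge-s : ∀ {A} (f g : Fin n → A) → merge f g s ≡ f s
    merge-s f g = cong (λ b → if b then g s else f s) (dec-false (s Finₚ.≟ t) (Finₚ.<⇒≢ s<t))

    merge-t : ∀ {A} (f g : Fin n → A) → merge f g t ≡ g t
    merge-t f g = cong (λ b → if b then g t else f t) (dec-true (t Finₚ.≟ t) refl)

    mix : Fin (n * k) → Fin (n * k + n * k)
    mix x = mixAt (proj₁ (remQuot {n} k x)) x

    module _ (N : ℕ) where

      -- Copies within a column are named by pairs `(c , i)`: `c` codes a subset, `i` an element,
      -- and digit `i` of `c` decides the edge. Place `zero` is a dummy for the rows that stand for
      -- a subset.
      Index : Set
      Index = Fin (2 ^ suc N)

      digits : Subset N → Fin (suc N) → Fin 2
      digits w zero    = zero
      digits w (suc i) = bit (lookup w i)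

      code : Subset N → Index
      code w = funToFin (digits w)

      digit : Index → Fin (suc N) → Bool
      digit c i = unbit (finToFun {2} {suc N} c i)

      digit-code : ∀ w i → digit (code w) (suc i) ≡ lookup w i
      digit-code w i = trans (cong unbit (Finₚ.finToFun-funToFin (digits w) (suc i))) (unbit-bit (lookup w i))

      width : ℕ
      width = 2 ^ suc N * suc N

      pairEdge : Fin n × Index × Fin (suc N) → Fin n × Index × Fin (suc N) → Bool
      pairEdge (r , c , _) (r′ , _ , i) = lookup (G [ combine s t ]≔ pol (digit c i)) (combine r r′)

      split : Fin (n * width) → Fin n × Index × Fin (suc N)
      split x = let r , z = remQuot {n} width x in r , remQuot {2 ^ suc N} (suc N) z

      vertices : Σ[ e ∈ Vec (Carrier I) (n * width) ] Monotone I (lookup e) ×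
        (∀ x y → x Fin.< y → Adj I (lookup e x) (lookup e y) ⇔ pairEdge (split x) (split y) ≡ true)
      vertices = embeds (λ x y → pairEdge (split x) (split y))

      join : Fin n → Index → Fin (suc N) → Fin (n * width)
      join r c i = combine r (combine c i)

      split-join : ∀ r c i → split (join r c i) ≡ (r , c , i)
      split-join r c i = trans
        (cong (λ (r , z) → r , remQuot {2 ^ suc N} (suc N) z) (Finₚ.remQuot-combine r (combine c i)))
        (cong (r ,_) (Finₚ.remQuot-combine c i))

      row : (Fin n → Index × Fin (suc N)) → Vec (Carrier I) n
      row f = tabulate λ r → lookup (proj₁ vertices) (join r (proj₁ (f r)) (proj₂ (f r)))

      row-monotone : ∀ f → Monotone I (lookup (row f))
      row-monotone f x y x<y = subst₂ (Lt I) (sym (Vecₚ.lookup∘tabulate _ x)) (sym (Vecₚ.lookup∘tabulate _ y))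
        (proj₁ (proj₂ vertices) _ _ (Finₚ.combine-monoˡ-< _ _ x<y))

      row-adj : ∀ f x y → x Fin.< y →
                Adj I (lookup (row f) x) (lookup (row f) y) ⇔ pairEdge (x , f x) (y , f y) ≡ true
      row-adj f x y x<y = mk⇔
        (λ p → trans (sym split-eq) (to adj
          (subst₂ (Adj I) (Vecₚ.lookup∘tabulate _ x) (Vecₚ.lookup∘tabulate _ y) p)))
        (λ q → subst₂ (Adj I) (sym (Vecₚ.lookup∘tabulate _ x)) (sym (Vecₚ.lookup∘tabulate _ y))
                 (from adj (trans split-eq q)))
        where
        vx = join x (proj₁ (f x)) (proj₂ (f x))
        vy = join y (proj₁ (f y)) (proj₂ (f y))
        adj = proj₂ (proj₂ vertices) vx vy (Finₚ.combine-monoˡ-< _ _ x<y)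
        split-eq : pairEdge (split vx) (split vy) ≡ pairEdge (x , f x) (y , f y)
        split-eq = cong₂ pairEdge (split-join x (proj₁ (f x)) (proj₂ (f x)))
                                  (split-join y (proj₁ (f y)) (proj₂ (f y)))

      left : Subset N → Fin n → Index × Fin (suc N)
      left w _ = code w , zero

      right : Fin N → Fin n → Index × Fin (suc N)
      right i _ = zero′ , suc i
        where
        zero′ : Index
        zero′ = funToFin {suc N} λ _ → zero

      -- Only column `t` comes from the row of `i`, so the one entry that varies is the edge from
      -- the copy of `s` named by `w` to the copy of `t` named by `i`.
      mixed : Subset N → Fin N → Fin n → Index × Fin (suc N)
      mixed w i = merge (left w) (right i)

      mixed-copy : ∀ w i → Copy (row (mixed w i)) (G [ combine s t ]≔ pol (lookup w i))
      mixed-copy w i = row-monotone (mixed w i) , λ x y x<y → mk⇔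
        (λ p → trans (sym (edge-eq x y)) (to (row-adj (mixed w i) x y x<y) p))
        (λ q → from (row-adj (mixed w i) x y x<y) (trans (edge-eq x y) q))
        where
        digit-mixed : digit (proj₁ (mixed w i s)) (proj₂ (mixed w i t)) ≡ lookup w i
        digit-mixed = trans (cong₂ (λ x y → digit (proj₁ x) (proj₂ y))
          (merge-s (left w) (right i)) (merge-t (left w) (right i))) (digit-code w i)

        edge-eq : ∀ x y → pairEdge (x , mixed w i x) (y , mixed w i y) ≡
                  lookup (G [ combine s t ]≔ pol (lookup w i)) (combine x y)
        edge-eq x y with combine x y Finₚ.≟ combine s t
        ... | no off = trans (Vecₚ.lookup∘update′ off G _) (sym (Vecₚ.lookup∘update′ off G _))
        ... | yes eq with Finₚ.combine-injective x y s t eq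
        ...   | refl , refl = cong (λ b → lookup (G [ combine s t ]≔ pol b) (combine s t)) digit-mixed

      mix-⊨ : ∀ w i →
        (M ⊨ rename mix ψ [ tuple I M a (row (left w)) ++ tuple I M a (row (right i)) ]) ⇔ lookup w i ≡ true
      mix-⊨ w i = mk⇔
        (λ p → to (flipped _) (from (true⇔ n ψ G′ (row (mixed w i)) copy) (to mixing p)))
        (λ q → from mixing (to (true⇔ n ψ G′ (row (mixed w i)) copy) (from (flipped _) q)))
        where
        copy = mixed-copy w i
        G′ = G [ combine s t ]≔ pol (lookup w i)

        mixing = ⊨-rename-tuple I M a mix (tuple I M a (row (left w)) ++ tuple I M a (row (right i)))
          (row (mixed w i)) (λ r j → blocks r j) ψ
          where
          V W : Vec (Carrier M) (n * k)
          V = tuple I M a (row (left w))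
          W = tuple I M a (row (right i))

          block : ∀ f r j → lookup (tuple I M a (row f)) (combine r j) ≡
                  lookup (a (lookup (proj₁ vertices) (join r (proj₁ (f r)) (proj₂ (f r))))) j
          block f r j = trans (lookup-tuple I M a (row f) r j)
                              (cong (λ i → lookup (a i) j) (Vecₚ.lookup∘tabulate _ r))

          mixAt-block : ∀ f g r j →
            lookup (tuple I M a (row f) ++ tuple I M a (row g)) (mixAt r (combine r j)) ≡
            lookup (tuple I M a (row (merge f g))) (combine r j)
          mixAt-block f g r j = begin
            lookup (tuple I M a (row f) ++ tuple I M a (row g)) (mixAt r (combine r j))
              ≡⟨ lookup-++-if (tuple I M a (row f)) (tuple I M a (row g)) b ⟩
            (if b then lookup (tuple I M a (row g)) (combine r j)
                  else lookup (tuple I M a (row f)) (combine r j))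
              ≡⟨ cong₂ (λ y z → if b then y else z) (block g r j) (block f r j) ⟩
            (if b then entry (g r) else entry (f r))
              ≡⟨ Boolₚ.if-float entry b ⟨
            entry (merge f g r)
              ≡⟨ block (merge f g) r j ⟨
            lookup (tuple I M a (row (merge f g))) (combine r j) ∎
            where
            open ≡-Reasoning
            b = does (r Finₚ.≟ t)
            entry : Index × Fin (suc N) → Carrier M
            entry (c , i) = lookup (a (lookup (proj₁ vertices) (join r c i))) j

          blocks : ∀ r j → lookup (V ++ W) (mix (combine r j)) ≡ lookup (a (lookup (row (mixed w i)) r)) j
          blocks r j = trans
            (cong (λ x → lookup (V ++ W) (mixAt (proj₁ x) (combine r j))) (Finₚ.remQuot-combine {n} {k} r j))
            (trans (mixAt-block (left w) (right i) r j) (lookup-tuple I M a (row (mixed w i)) r j))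

    flip⇒IP : HasIP T
    flip⇒IP = n * k , n * k , rename mix ψ , λ N → M , M⊨T
      , (λ i → tuple I M a (row N (right N i))) , (λ w → tuple I M a (row N (left N w)))
      , λ w i → mk⇔ (λ p → Vecₚ.lookup⇒[]= i w (to (mix-⊨ N w i) p))
                    (λ i∈w → from (mix-⊨ N w i) (Vecₚ.[]=⇒lookup i∈w))

  true-flip : ∀ n (ψ : Formula L (n * k)) (G : Vec Bool (n * n)) e →
              True n ψ (G [ e ]≔ true) ⇔ True n ψ (G [ e ]≔ false)
  true-flip n ψ G e = subst (λ e → True n ψ (G [ e ]≔ true) ⇔ True n ψ (G [ e ]≔ false))
    (Finₚ.combine-remQuot {n} n e) (by-edge (proj₁ (remQuot {n} n e)) (proj₂ (remQuot {n} n e)))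
    where
    by-edge : ∀ s t → True n ψ (G [ combine s t ]≔ true) ⇔ True n ψ (G [ combine s t ]≔ false)
    by-edge s t with s Finₚ.<? t
    ... | no s≮t = mk⇔
      (λ p i copy → p i (irrelevant false true i copy))
      (λ p i copy → p i (irrelevant true false i copy))
      where
      irrelevant : ∀ b c (i : Vec (Carrier I) n) →
                   Copy i (G [ combine s t ]≔ b) → Copy i (G [ combine s t ]≔ c)
      irrelevant b c i (mono , adj) = mono , λ x y x<y →
        let off = λ eq → case Finₚ.combine-injective x y s t eq of λ { (refl , refl) → s≮t x<y }
            unchanged = λ b → Vecₚ.lookup∘update′ off G b
        in mk⇔ (λ p → trans (unchanged c) (trans (sym (unchanged b)) (to (adj x y x<y) p)))
               (λ q → from (adj x y x<y) (trans (unchanged b) (trans (sym (unchanged c)) q)))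
    ... | yes s<t with em {True n ψ (G [ combine s t ]≔ true)} | em {True n ψ (G [ combine s t ]≔ false)}
    ...   | yes p | yes q = mk⇔ (λ _ → q) (λ _ → p)
    ...   | no ¬p | no ¬q = mk⇔ (λ p → contradiction p ¬p) (λ q → contradiction q ¬q)
    -- The edge now decides `ψ`, here positively and in the last case negatively.
    ...   | yes p | no ¬q = contradiction (flip⇒IP n ψ G s t s<t id λ
      { true → mk⇔ (λ _ → refl) (λ _ → p) ; false → mk⇔ (λ q → contradiction q ¬q) (λ ()) }) nip
    ...   | no ¬p | yes q = contradiction (flip⇒IP n ψ G s t s<t not λ
      { true → mk⇔ (λ _ → refl) (λ _ → q) ; false → mk⇔ (λ p → contradiction p ¬p) (λ ()) }) nip

  graphOf : ∀ {n} → Vec (Carrier I) n → Vec Bool (n * n)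
  graphOf {n} i = tabulate λ e →
    let x , y = remQuot {n} n e in ⌊ Adj I (lookup i x) (lookup i y) ⌋

  copy-graphOf : ∀ {n} (i : Vec (Carrier I) n) → Increasing I i → Copy i (graphOf i)
  copy-graphOf {n} i inc = (λ x y x<y → lookup⁺ Lt-trans inc x<y) , λ x y x<y →
    let eq = trans (Vecₚ.lookup∘tabulate _ (combine x y))
                   (cong (λ (x , y) → ⌊ Adj I (lookup i x) (lookup i y) ⌋) (Finₚ.remQuot-combine {n} {n} x y))
    in mk⇔ (λ p → trans eq (⌊⌋-intro p)) (λ q → ⌊⌋-elim (trans (sym eq) q))

  tp-⊆ : ∀ n (i j : Vec (Carrier I) n) → Increasing I i → Increasing I j →
         ∀ {ψ} → ψ ∈ tp M (tuple I M a i) → ψ ∈ tp M (tuple I M a j)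
  tp-⊆ n i j i-inc j-inc {ψ} p = to (true⇔ n ψ (graphOf j) j (copy-graphOf j j-inc))
    (flip-invariant (True n ψ) (true-flip n ψ) (graphOf i) (graphOf j)
      (from (true⇔ n ψ (graphOf i) i (copy-graphOf i i-inc)) p))

  indiscernible : IsIndiscernibleSequence I M a
  indiscernible n i j i-inc j-inc =
    (λ {ψ} → tp-⊆ n i j i-inc j-inc {ψ}) , (λ {ψ} → tp-⊆ n j i j-inc i-inc {ψ})

-- IP yields an ordered graph-indiscernible that does not collapse

thinning : ∀ n N (e : Fin n → ℕ) → (∀ x y → x Fin.< y → e x ℕ.< e y) → (∀ x → e x ℕ.< N) →
           Σ[ θ ∈ Thinning n N ] (∀ x → toℕ (embed θ x) ≡ e x)
thinning zero    zero    e mono e<N = done , λ ()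
thinning (suc n) zero    e mono e<N = case e<N zero of λ ()
thinning zero    (suc N) e mono e<N with thinning zero N (λ ()) (λ ()) (λ ())
... | θ , eq = skip θ , λ ()
thinning (suc n) (suc N) e mono e<N with e zero in e₀
... | zero = keep (proj₁ rest) , λ
  { zero    → sym e₀
  ; (suc x) → trans (cong suc (proj₂ rest x)) (ℕₚ.suc-pred (e (suc x)) ⦃ positive x ⦄) }
  where
  positive : ∀ x → ℕ.NonZero (e (suc x))
  positive x = ℕ.>-nonZero (ℕₚ.≤-<-trans z≤n (mono zero (suc x) (s≤s z≤n)))

  rest = thinning n N (ℕ.pred ∘ e ∘ suc)
    (λ x y x<y → ℕₚ.pred-mono-< ⦃ positive x ⦄ (mono (suc x) (suc y) (s≤s x<y)))
    (λ x → ℕₚ.<-≤-trans (ℕₚ.pred-mono-< ⦃ positive x ⦄ (e<N (suc x))) ℕₚ.≤-refl)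
... | suc m = skip (proj₁ rest) , λ x →
  trans (cong suc (proj₂ rest x)) (ℕₚ.suc-pred (e x) ⦃ positive x ⦄)
  where
  positive : ∀ x → ℕ.NonZero (e x)
  positive zero    = ℕ.>-nonZero (subst (0 ℕ.<_) (sym e₀) (s≤s z≤n))
  positive (suc x) = ℕ.>-nonZero (ℕₚ.≤-<-trans z≤n (mono zero (suc x) (s≤s z≤n)))

  rest = thinning (suc n) N (ℕ.pred ∘ e)
    (λ x y x<y → ℕₚ.pred-mono-< ⦃ positive x ⦄ (mono x y x<y))
    (λ x → ℕₚ.pred-mono-< ⦃ positive x ⦄ (e<N x))

bounded : ∀ {n} (f : Fin n → ℕ) → ∃[ B ] (∀ x → f x ℕ.< B)
bounded {zero}  f = 0 , λ ()
bounded {suc n} f with bounded (f ∘ suc)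
... | B , f<B = suc (f zero) ℕ.⊔ B , λ
  { zero    → ℕₚ.m≤m⊔n (suc (f zero)) B
  ; (suc x) → ℕₚ.≤-trans (f<B x) (ℕₚ.m≤n⊔m (suc (f zero)) B) }

≡true-ext : ∀ {x y} → (x ≡ true → y ≡ true) → (y ≡ true → x ≡ true) → x ≡ y
≡true-ext {true}          f g = sym (f refl)
≡true-ext {false} {true}  f g = g refl
≡true-ext {false} {false} f g = refl

-- For nontriviality: the formula that links `w` to `i` but not to `j` tells their tuples apart.
rado-separates : ∀ {i j} → i ≢ j → ∃[ w ] rado w i ≡ true × rado w j ≡ false
rado-separates {i} {j} i≢j =
  w , digit i i≤m (dec-true (i ℕₚ.≟ i) refl) , digit j j≤m (dec-false (j ℕₚ.≟ i) (i≢j ∘ sym))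
  where
  m = suc (i ℕ.⊔ j)
  g = λ t → does (t ℕₚ.≟ i)
  w = fromDigits g m

  i≤m : i ℕ.< m
  i≤m = s≤s (ℕₚ.m≤m⊔n i j)
  j≤m : j ℕ.< m
  j≤m = s≤s (ℕₚ.m≤n⊔m i j)

  digit : ∀ t {b} → t ℕ.< m → g t ≡ b → rado w t ≡ b
  digit t t<m eq = trans (rado-sym w t) (trans (rado-< (ℕₚ.<-trans t<m (<-fromDigits g m)))
    (trans (binaryDigit-fromDigits g m t t<m) eq))

distinct⇒1≤length : ∀ {ℓ} {A : Set ℓ} {k} {v w : Vec A k} → v ≢ w → 1 ℕ.≤ k
distinct⇒1≤length {k = zero}  {[]} {[]} v≢w = contradiction refl v≢w
distinct⇒1≤length {k = suc k} v≢w = s≤s z≤n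

module Backward {ℓ : Level} (em : ExcludedMiddle ℓ) (ext : Extensionality ℓ 0ℓ)
                (L : Language ℓ) (T : Theory L) (p q : ℕ) (φ : Formula L (p + q)) where

  open Classical em ext

  k : ℕ
  k = p + q

  I : Structure Lg ℓ
  I = radoGraph ℓ

  -- A finite requirement on the coding: the formula has the same truth value on all
  -- increasing copies of the graph below the bound.
  record Task : Set ℓ where
    field
      size    : ℕ
      formula : Formula L (size * k)
      graph   : Fin size → Fin size → Bool
      bound   : ℕ

  open Task
  open Ultrafilter Task

  Below : ∀ {n} → ℕ → Vec (Carrier I) n → Set
  Below B v = ∀ r → lower (lookup v r) ℕ.< B

  HasGraph : ∀ {n} → Vec (Carrier I) n → (Fin n → Fin n → Bool) → Set
  HasGraph v F = ∀ r s → rado (lower (lookup v r)) (lower (lookup v s)) ≡ F r s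

  maxBound : List Task → ℕ
  maxBound []       = 0
  maxBound (t ∷ ts) = bound t ℕ.⊔ maxBound ts

  bound≤maxBound : ∀ {t ts} → t ∈ᴸ ts → bound t ℕ.≤ maxBound ts
  bound≤maxBound {ts = t ∷ ts} (hereᴸ refl) = ℕₚ.m≤m⊔n (bound t) (maxBound ts)
  bound≤maxBound {ts = t ∷ ts} (thereᴸ t∈)  =
    ℕₚ.≤-trans (bound≤maxBound t∈) (ℕₚ.m≤n⊔m (bound t) (maxBound ts))

  -- Of two vertex tuples of the form `b ++ a`, the first supplies the variables `x` of `φ` and the
  -- second the variables `y`.
  link : Formula L (2 * k)
  link = rename (λ z →
    [ (λ x → combine {2} zero (x ↑ˡ q)) , (λ y → combine {2} (suc zero) (p ↑ʳ y)) ]′ (splitAt p z)) φ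

  link-⊨ : (M : Structure L ℓ) (a : Carrier I → Vec (Carrier M) k) → ∀ i j {b b′ c c′} →
           a i ≡ b ++ c′ → a j ≡ b′ ++ c →
           (M ⊨ link [ tuple I M a (i ∷ j ∷ []) ]) ⇔ (M ⊨ φ [ b ++ c ])
  link-⊨ M a i j {b} {b′} {c} {c′} aᵢ aⱼ = ⊨-rename M _ entries φ
    where
    v = tuple I M a (i ∷ j ∷ [])

    entries : ∀ z → lookup (b ++ c) z ≡ lookup v
      ([ (λ x → combine {2} zero (x ↑ˡ q)) , (λ y → combine {2} (suc zero) (p ↑ʳ y)) ]′ (splitAt p z))
    entries z with splitAt p z | Vecₚ.lookup-splitAt p b c z
    ... | inj₁ x | eq = trans eq (sym (trans (lookup-tuple I M a (i ∷ j ∷ []) zero (x ↑ˡ q))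
      (trans (cong (λ u → lookup u (x ↑ˡ q)) aᵢ) (Vecₚ.lookup-++ˡ b c′ x))))
    ... | inj₂ y | eq = trans eq (sym (trans (lookup-tuple I M a (i ∷ j ∷ []) (suc zero) (p ↑ʳ y))
      (trans (cong (λ u → lookup u (p ↑ʳ y)) aⱼ) (Vecₚ.lookup-++ʳ b′ c y))))

  link-cong : (M : Structure L ℓ) (a : Carrier I → Vec (Carrier M) k) → ∀ w i j → a i ≡ a j →
              M ⊨ link [ tuple I M a (w ∷ i ∷ []) ] → M ⊨ link [ tuple I M a (w ∷ j ∷ []) ]
  link-cong M a w i j aᵢ≡aⱼ = subst (λ u → M ⊨ link [ a w ++ (u ++ []) ]) aᵢ≡aⱼ

  record Approximation (x : List Task) : Set (lsuc ℓ) where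
    field
      model   : Structure L ℓ
      model⊨T : model ⊨ᵀ T
      family  : Carrier I → Vec (Carrier model) k
      linked  : ∀ i j → i ℕ.< maxBound x → j ℕ.< maxBound x →
                (model ⊨ link [ tuple I model family (lift i ∷ lift j ∷ []) ]) ⇔ rado i j ≡ true
      uniform : ∀ t → t ∈ᴸ x → ∀ v w → Monotone I (lookup v) → Monotone I (lookup w) →
                Below (bound t) v → Below (bound t) w → HasGraph v (graph t) → HasGraph w (graph t) →
                model ⊨ formula t [ tuple I model family v ] → model ⊨ formula t [ tuple I model family w ]

  Shatters : ℕ → Set (lsuc ℓ)
  Shatters n = Σ[ M ∈ Structure L ℓ ] M ⊨ᵀ T ×
    Σ[ a ∈ (Fin n → Vec (Carrier M) q) ] Σ[ b ∈ (Subset n → Vec (Carrier M) p) ]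
      (∀ w i → (M ⊨ φ [ b w ++ a i ]) ⇔ (i ∈ₛ w))

  -- The Ramsey bound for the Rado graph on the vertices below `maxBound x` comes first, and IP is
  -- applied at that size. A tuple is then coloured by the truth value of the formula of the task.
  approximate : (∀ n → Shatters n) → ∀ x → Approximation x
  approximate ip x with orderedGraphRamsey size graph x (maxBound x) (λ v w → rado (toℕ v) (toℕ w))
  ... | N′ , ramsey with ip N′
  ... | M , M⊨T , c , b , shatters = build (ramsey colour)
    where
    N = maxBound x

    value : Vec Bool N′ × Fin N′ → Vec (Carrier M) k
    value (S , u) = b S ++ c u

    colour : ∀ t → Vec (Vec Bool N′ × Fin N′) (size t) → Bool
    colour t v = ⌊ M ⊨ formula t [ concat (map value v) ] ⌋

    build : UniformCopy size graph x (λ v w → rado (toℕ v) (toℕ w)) colour → Approximation x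
    build (A , edges , uniform) = record
      { model = M ; model⊨T = M⊨T ; family = family ; linked = linked ; uniform = uniform′ }
      where
      family : Carrier I → Vec (Carrier M) k
      family (lift i) with i ℕₚ.<? N
      ... | yes i<N = value (A (fromℕ< i<N))
      -- A default beyond the bound, where no requirement of `x` reaches.
      ... | no _    = replicate k (point M)

      family-< : ∀ {i} v → toℕ v ≡ i → family (lift i) ≡ value (A v)
      family-< {i} v refl with toℕ v ℕₚ.<? N
      ... | yes v<N = cong (λ v → value (A v)) (Finₚ.fromℕ<-toℕ v v<N)
      ... | no v≮N  = contradiction (Finₚ.toℕ<n v) v≮N

      linked : ∀ i j → i ℕ.< N → j ℕ.< N →
               (M ⊨ link [ tuple I M family (lift i ∷ lift j ∷ []) ]) ⇔ rado i j ≡ true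
      linked i j i<N j<N = mk⇔
        (λ linkᵢⱼ → trans (sym edgeᵢⱼ) (Vecₚ.[]=⇒lookup (to (shatters S u) (to link⇔ linkᵢⱼ))))
        (λ adj → from link⇔ (from (shatters S u) (Vecₚ.lookup⇒[]= u S (trans edgeᵢⱼ adj))))
        where
        v = fromℕ< i<N
        w = fromℕ< j<N
        edgeᵢⱼ : lookup (proj₁ (A v)) (proj₂ (A w)) ≡ rado i j
        edgeᵢⱼ = trans (edges v w) (cong₂ rado (Finₚ.toℕ-fromℕ< i<N) (Finₚ.toℕ-fromℕ< j<N))
        S = proj₁ (A v)
        u = proj₂ (A w)
        link⇔ = link-⊨ M family (lift i) (lift j) {b S} {b (proj₁ (A w))} {c u} {c (proj₂ (A v))}
          (family-< v (Finₚ.toℕ-fromℕ< i<N)) (family-< w (Finₚ.toℕ-fromℕ< j<N))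

      homogeneous : ∀ t → (t∈ : t ∈ᴸ x) → ∀ v → Monotone I (lookup v) → Below (bound t) v →
        HasGraph v (graph t) → ⌊ M ⊨ formula t [ tuple I M family v ] ⌋ ≡ proj₁ (uniform t∈)
      homogeneous t t∈ v v-mono v<B v-graph with thinning (size t) N (lower ∘ lookup v)
        (λ r s r<s → lower (v-mono r s r<s)) (λ r → ℕₚ.<-≤-trans (v<B r) (bound≤maxBound t∈))
      ... | θ , θ≡v = trans (cong (λ u → ⌊ M ⊨ formula t [ concat u ] ⌋) values)
        (proj₂ (uniform t∈) θ (λ r s → trans (cong₂ rado (θ≡v r) (θ≡v s)) (v-graph r s)))
        where
        values : map family v ≡ map value (tabulate (A ∘ embed θ))
        values = begin
          map family v                             ≡⟨ cong (map family) (Vecₚ.tabulate∘lookup v) ⟨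
          map family (tabulate (lookup v))         ≡⟨ Vecₚ.tabulate-∘ family (lookup v) ⟨
          tabulate (family ∘ lookup v)             ≡⟨ Vecₚ.tabulate-cong (λ r → family-< (embed θ r) (θ≡v r)) ⟩
          tabulate (value ∘ A ∘ embed θ)           ≡⟨ Vecₚ.tabulate-∘ value (A ∘ embed θ) ⟩
          map value (tabulate (A ∘ embed θ))       ∎
          where open ≡-Reasoning

      uniform′ : ∀ t → t ∈ᴸ x → ∀ v w → Monotone I (lookup v) → Monotone I (lookup w) →
        Below (bound t) v → Below (bound t) w → HasGraph v (graph t) → HasGraph w (graph t) →
        M ⊨ formula t [ tuple I M family v ] → M ⊨ formula t [ tuple I M family w ]
      uniform′ t t∈ v w v-mono w-mono v<B w<B v-graph w-graph ⊨v = ⌊⌋-elim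
        (trans (homogeneous t t∈ w w-mono w<B w-graph)
        (trans (sym (homogeneous t t∈ v v-mono v<B v-graph)) (⌊⌋-intro ⊨v)))

  module Limit (approximation : ∀ x → Approximation x) where

    module A x = Approximation (approximation x)
    open Ultraproduct em ext L Task A.model

    M : Structure L ℓ
    M = ultraproduct

    a : Carrier I → Vec (Carrier M) k
    a = ultrafamily I A.family

    M⊨T : M ⊨ᵀ T
    M⊨T = ultraproduct-⊨ᵀ A.model⊨T

    -- Uses the cone of an empty task whose only content is its bound.
    largeBound : ∀ B → Large (λ x → Lift ℓ (B ℕ.≤ maxBound x))
    largeBound B = large-cone
      (record { size = 0 ; formula = ⊥ᶠ ; graph = λ () ; bound = B })
      (λ x t∈x → lift (bound≤maxBound t∈x))

    large-linked : ∀ i j → Large (λ x →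
      (A.model x ⊨ link [ tuple I (A.model x) (A.family x) (lift i ∷ lift j ∷ []) ]) ⇔ rado i j ≡ true)
    large-linked i j = large-map
      (λ x (lift B≤) → A.linked x i j (ℕₚ.≤-trans (s≤s (ℕₚ.m≤m⊔n i j)) B≤)
                                      (ℕₚ.≤-trans (s≤s (ℕₚ.m≤n⊔m i j)) B≤))
      (largeBound (suc (i ℕ.⊔ j)))

    linked⁺ : ∀ i j → M ⊨ link [ tuple I M a (lift i ∷ lift j ∷ []) ] → rado i j ≡ true
    linked⁺ i j ⊨link = lower (proj₂ (large-∃ (large-zip (λ x iff ⊨x → lift (to iff ⊨x))
      (large-linked i j) (tuple-⁺ I A.family link (lift i ∷ lift j ∷ []) ⊨link))))

    linked⁻ : ∀ i j → rado i j ≡ true → M ⊨ link [ tuple I M a (lift i ∷ lift j ∷ []) ]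
    linked⁻ i j adj = tuple-⁻ I A.family link (lift i ∷ lift j ∷ [])
      (large-map (λ x iff → from iff adj) (large-linked i j))

    nontrivial : ∀ i j → i ≢ j → a i ≢ a j
    nontrivial (lift i) (lift j) i≢j aᵢ≡aⱼ =
      let w , rᵢ , rⱼ = rado-separates (λ i≡j → i≢j (cong lift i≡j))
      in case trans (sym rⱼ) (linked⁺ w j
           (link-cong M a (lift w) (lift i) (lift j) aᵢ≡aⱼ (linked⁻ w i rᵢ))) of λ ()

    -- After sorting, passing from `i` to `j` is an instance of a single task, with `ψ` rewritten
    -- for sorted tuples, and the lists that contain this task form a large set.
    tp-⊆ : ∀ n (i j : Vec (Carrier I) n) → SameAtoms I I (lookup i) (lookup j) →
           ∀ ψ → M ⊨ ψ [ tuple I M a i ] → M ⊨ ψ [ tuple I M a j ]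
    tp-⊆ n i j same ψ ⊨i = to (⊨-substituteBlocks I M a σ j w j-factor ψ)
      (tuple-⁻ I A.family ψ′ w (large-zip transfer transferable
        (tuple-⁺ I A.family ψ′ v (from (⊨-substituteBlocks I M a σ i v i-factor ψ) ⊨i))))
      where
      open TgModel.Sorting (TgModel.sorting em (radoGraph-⊨Tg ℓ) (lookup i))
      open SameAtoms same

      v w : Vec (Carrier I) number
      v = tabulate (lookup i ∘ τ)
      w = tabulate (lookup j ∘ τ)

      v-lookup : ∀ r → lookup v r ≡ lookup i (τ r)
      v-lookup = Vecₚ.lookup∘tabulate (lookup i ∘ τ)
      w-lookup : ∀ r → lookup w r ≡ lookup j (τ r)
      w-lookup = Vecₚ.lookup∘tabulate (lookup j ∘ τ)

      i-factor : ∀ r → lookup v (σ r) ≡ lookup i r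
      i-factor r = trans (v-lookup (σ r)) (factor r)
      j-factor : ∀ r → lookup w (σ r) ≡ lookup j r
      j-factor r = trans (w-lookup (σ r)) (to (equal (τ (σ r)) r) (factor r))

      v-mono : Monotone I (lookup v)
      v-mono x y x<y = subst₂ (Lt I) (sym (v-lookup x)) (sym (v-lookup y)) (monotone x y x<y)
      w-mono : Monotone I (lookup w)
      w-mono x y x<y = subst₂ (Lt I) (sym (w-lookup x)) (sym (w-lookup y))
        (to (ordered (τ x) (τ y)) (monotone x y x<y))

      F : Fin number → Fin number → Bool
      F x y = rado (lower (lookup i (τ x))) (lower (lookup i (τ y)))

      v-graph : HasGraph v F
      v-graph x y = cong₂ (λ y z → rado (lower y) (lower z)) (v-lookup x) (v-lookup y)
      w-graph : HasGraph w F
      w-graph x y = trans (cong₂ (λ y z → rado (lower y) (lower z)) (w-lookup x) (w-lookup y))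
        (≡true-ext (λ r → lower (from (adjacent (τ x) (τ y)) (lift r)))
                   (λ r → lower (to (adjacent (τ x) (τ y)) (lift r))))

      v-bound = bounded (lower ∘ lookup v)
      w-bound = bounded (lower ∘ lookup w)

      ψ′ : Formula L (number * k)
      ψ′ = rename (substituteBlocks k σ) ψ

      task : Task
      task = record { size = number ; formula = ψ′ ; graph = F ; bound = proj₁ v-bound ℕ.⊔ proj₁ w-bound }

      transferable : Large (λ x → task ∈ᴸ x)
      transferable = large-cone task (λ x t∈x → t∈x)

      transfer : ∀ x → task ∈ᴸ x → A.model x ⊨ ψ′ [ tuple I (A.model x) (A.family x) v ] →
                 A.model x ⊨ ψ′ [ tuple I (A.model x) (A.family x) w ]
      transfer x t∈x = A.uniform x task t∈x v w v-mono w-mono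
        (λ r → ℕₚ.<-≤-trans (proj₂ v-bound r) (ℕₚ.m≤m⊔n (proj₁ v-bound) (proj₁ w-bound)))
        (λ r → ℕₚ.<-≤-trans (proj₂ w-bound r) (ℕₚ.m≤n⊔m (proj₁ v-bound) (proj₁ w-bound)))
        v-graph w-graph

    graph-indiscernible : IsGeneralizedIndiscernible I M a
    graph-indiscernible = nontrivial , λ n i j same →
        (λ {ψ} → tp-⊆ n i j (qftp⇒sameAtoms {i = i} {j} same) ψ)
      , (λ {ψ} → tp-⊆ n j i (qftp⇒sameAtoms {i = j} {i} (proj₂ same , proj₁ same)) ψ)

    -- Tuples of length zero could not be distinct.
    1≤k : 1 ℕ.≤ k
    1≤k = distinct⇒1≤length (nontrivial (lift 0) (lift 1) (λ ()))

    not-indiscernible : ¬ IsIndiscernibleSequence I M a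
    -- In the Rado graph 0 is adjacent to 1 but not to 2: the lowest binary digit of 1 is 1 and that
    -- of 2 is 0.
    not-indiscernible ind = case linked⁺ 0 2 (proj₁ (ind 2 (lift 0 ∷ lift 1 ∷ []) (lift 0 ∷ lift 2 ∷ [])
      (lift (s≤s z≤n) ∷ [-]) (lift (s≤s z≤n) ∷ [-])) {link} (linked⁻ 0 1 refl)) of λ ()

theorem5p10 :
    (∀ {a} → ExcludedMiddle a) →
    (∀ {a b} → Extensionality a b) →
    ∀ {l} (L : Language l) (T : Theory L) →
    HasNIP T ⇔
    ((M : Structure L l) → M ⊨ᵀ T →
     (I : Structure Lg l) → IsQFWeaklySaturatedModel Tg I →
     (k : ℕ) → 1 ≤ k →
     (a : Carrier I → Vec (Carrier M) k) →
     IsGeneralizedIndiscernible I M a →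
     IsIndiscernibleSequence I M a)
theorem5p10 em ext L T = mk⇔
  (λ nip M M⊨T I I-sat k _ a ind →
    Forward.indiscernible em L T nip M M⊨T I (proj₁ I-sat) (saturated-embedding em {I} I-sat) k a ind)
  (λ collapse (p , q , φ , ip) →
    let open Backward em ext L T p q φ
        open Limit (approximate ip)
    in not-indiscernible (collapse M M⊨T I (radoGraph-saturated em) k 1≤k a graph-indiscernible))
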